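{- Let $m\ge 1$ be an integer. For every integer $n\ge 0$, $$D_{ -m}(n)=\det\bigl(C_{i+j-m}\bigr)_{i,j=0}^{n-1}=p_{m+1}(-n).$$ Equivalently: $D_{ -m}(n)=0$ for $1\le n\le m$, and for $n\ge m+1$ $$D_{ -m}(n)=(-1)^{\binom{m+1}{2}}\,p_{m+1}(n-m-1)=(-1)^{\binom{m+1}{2}}\,D_{m+1}(n-m-1).$$
   Context: $C_n=\frac{1}{n+1}\binom{2n}{n}$ for $n\ge 0$ are the Catalan numbers, extended to all $n\in\mathbb Z$ by $C_n=0$ for $n<0$. For $m\in\mathbb Z$ and $n\ge 0$, $D_m(n)=\det(C_{m+i+j})_{i,j=0}^{n-1}$ (the determinant of the $0\times 0$ matrix is $1$). For an integer $m\ge 0$, $p_m(n)$ denotes the polynomial in $n$ given by $p_m(n)=\prod_{1\le i\le j\le m-1}\frac{2n+i+j}{i+j}$ (empty product $=1$, so $p_0=p_1=1$); it is known that $D_m(n)=p_m(n)$ for all integers $m,n\ge 0$. -}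

module Defs where

open import Data.Nat.Base as ℕ using (ℕ; zero; suc)
open import Data.Nat.Combinatorics using (_C_)
open import Data.Integer.Base as ℤ using (ℤ; +_; -[1+_])
open import Data.Rational.Base
  using (ℚ; 1ℚ; _+_; _*_; -_; _/_; +-*-rawSemiring)
open import Data.Fin.Base using (Fin; zero; suc; toℕ; punchIn)
open import Algebra.Definitions.RawSemiring +-*-rawSemiring public
  using (sum; product; _^_)

fromℕ : ℕ → ℚ
fromℕ n = + n / 1

catalan : ℤ → ℚ
catalan (+ n)    = + ((2 ℕ.* n) C n) / suc n
catalan -[1+ _ ] = + 0 / 1

Matrix : ℕ → Set
Matrix n = Fin n → Fin n → ℚ

-- Laplace expansion along the first row; punchIn j skips column j.
det : (n : ℕ) → Matrix n → ℚ
det zero    A = 1ℚ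
det (suc n) A = sum {suc n} λ j →
  (- 1ℚ) ^ toℕ j * A zero j * det n (λ r c → A (suc r) (punchIn j c))

D : ℤ → ℕ → ℚ
D m n = det n λ i j → catalan (m ℤ.+ + toℕ i ℤ.+ + toℕ j)

-- The product over 1 ≤ i ≤ j ≤ m - 1. Fin is 0-based, so j = suc (toℕ b)
-- with b : Fin (m ∸ 1), and i = suc (toℕ a) with a : Fin j.
-- For m = 0 the range is empty, as it is for m = 1.
p : ℕ → ℚ → ℚ
p m x =
  product {m ℕ.∸ 1} λ b →
  product {suc (toℕ b)} λ a →
    factor (toℕ a) (toℕ b)
  where
  factor : ℕ → ℕ → ℚ
  factor a b = (fromℕ 2 * x + fromℕ i + fromℕ j) * (+ 1 / (i ℕ.+ j))
    where
    i = suc a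
    j = suc b

{-# OPTIONS --safe #-}

-- For m ≥ 0 the Hankel matrix (C_{m+i+j}) factors as L m · diag (h m) · (L m)ᵀ. The quotient-difference
-- table q, e of the Catalan numbers defines L and h and moves the factorisation from m to m + 1, so no
-- hypergeometric sum is needed, and D_m(n) = ∏_{k<n} h m k, which telescopes to p_m(n).
--
-- For -m, let c(x) be the Catalan generating function. Multiplying the rows of (C_{i+j-m}) by the
-- unitriangular Toeplitz matrix of 1/c(x) makes the first m + 1 columns an antidiagonal of ones over
-- zeros; the complementary lower block is the Hankel matrix (C_{m+1+i+j}) times the upper unitriangular
-- Toeplitz matrix of c(x), so its determinant is D_{m+1}(n-m-1).
-- Finally p_{m+1}(-n) = (-1)^{m(m+1)/2} p_{m+1}(n-m-1) is the symmetry (i, j) ↦ (m+1-j, m+1-i) of the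
-- index triangle.
module Submission where

open import Algebra.Bundles using (CommutativeRing)
import Algebra.Properties.CommutativeMonoid.Sum as CommutativeMonoidSum
import Algebra.Properties.Semiring.Sum as SemiringSum
open import Data.Fin.Base as Fin using (Fin; zero; suc; toℕ; punchIn)
import Data.Fin.Properties as Finₚ
import Data.Integer.Base as ℤ
import Data.Integer.Properties as ℤₚ
open import Data.Nat.Base as ℕ using (ℕ; zero; suc; _≤_; _<_; _∸_; z≤n; s≤s; _!)
open import Data.Nat.Combinatorics
  using (_C_; nC1≡n; nCk+nC[k+1]≡[n+1]C[k+1]; nCk≡n!/k![n-k]!; k![n∸k]!∣n!)
import Data.Nat.DivMod as ℕ÷
import Data.Nat.Properties as ℕₚ
import Data.Nat.Tactic.RingSolver as ℕ-Solver
open import Data.Product.Base using (_×_; _,_)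
open import Data.Rational.Base using (ℚ; 0ℚ; 1ℚ; _+_; _*_; -_; _-_; _/_; fromℚᵘ)
open import Data.Rational.Properties
open import Data.Rational.Unnormalised.Base as ℚᵘ using (mkℚᵘ; *≡*)
import Data.Rational.Unnormalised.Properties as ℚᵘₚ
open import Data.Vec.Functional using (_∷_)
open import Function.Base using (_∘_)
open import Level using (0ℓ)
open import Relation.Binary.PropositionalEquality
  using (_≡_; refl; sym; trans; cong; cong₂; subst; module ≡-Reasoning)
open import Relation.Nullary.Decidable using (dec⇒maybe; yes; no)
import Tactic.RingSolver as Solver
import Tactic.RingSolver.Core.AlmostCommutativeRing as ACR
open import Defs

open SemiringSum (CommutativeRing.semiring +-*-commutativeRing)
  using (sum-cong-≗; ∑-distrib-+; *-distribˡ-sum; sum-replicate-zero)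
open CommutativeMonoidSum (CommutativeRing.*-commutativeMonoid +-*-commutativeRing)
  using () renaming (∑-distrib-+ to ∏-distrib-*)
open ≡-Reasoning

-- Rational arithmetic

-- Behind `L`, `q` and `e` stand the monic orthogonal polynomials P_k^(m) of the moments C_{m+n},
-- which never appear themselves. `L m i k` is the coefficient of P_k^(m) in x^i, and the table
-- connects neighbouring families: x P_k^(m+1) = P_(k+1)^(m) + `q m k` P_k^(m) and P_k^(m) =
-- P_k^(m+1) + `e m k` P_(k-1)^(m+1). The first relation is the recursion that defines `L`, the
-- second is `L-suc`. Since `det` is an expansion along the first row, only left multiplication by a
-- unitriangular matrix is developed; a right factor is absorbed into the upper triangular part
-- instead. Matrices are indexed by ℕ and cut to size inside the determinants, which is where bounds
-- such as j < n come from.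

ℚ-ring : ACR.AlmostCommutativeRing 0ℓ 0ℓ
ℚ-ring = ACR.fromCommutativeRing +-*-commutativeRing (λ x → dec⇒maybe (0ℚ ≟ x))

fromℚᵘ-+ : ∀ x y → fromℚᵘ (x ℚᵘ.+ y) ≡ fromℚᵘ x + fromℚᵘ y
fromℚᵘ-+ x y = toℚᵘ-injective (ℚᵘₚ.≃-trans (toℚᵘ-fromℚᵘ (x ℚᵘ.+ y))
  (ℚᵘₚ.≃-sym (ℚᵘₚ.≃-trans (toℚᵘ-homo-+ (fromℚᵘ x) (fromℚᵘ y))
    (ℚᵘₚ.+-cong (toℚᵘ-fromℚᵘ x) (toℚᵘ-fromℚᵘ y)))))

fromℚᵘ-* : ∀ x y → fromℚᵘ (x ℚᵘ.* y) ≡ fromℚᵘ x * fromℚᵘ y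
fromℚᵘ-* x y = toℚᵘ-injective (ℚᵘₚ.≃-trans (toℚᵘ-fromℚᵘ (x ℚᵘ.* y))
  (ℚᵘₚ.≃-sym (ℚᵘₚ.≃-trans (toℚᵘ-homo-* (fromℚᵘ x) (fromℚᵘ y))
    (ℚᵘₚ.*-cong (toℚᵘ-fromℚᵘ x) (toℚᵘ-fromℚᵘ y)))))

fromℕ-+ : ∀ a b → fromℕ (a ℕ.+ b) ≡ fromℕ a + fromℕ b
fromℕ-+ a b = trans
  (fromℚᵘ-cong {mkℚᵘ (ℤ.+ (a ℕ.+ b)) 0} {mkℚᵘ (ℤ.+ a) 0 ℚᵘ.+ mkℚᵘ (ℤ.+ b) 0}
    (*≡* (cong (ℤ._* ℤ.+ 1) (cong₂ ℤ._+_ (sym (ℤₚ.*-identityʳ (ℤ.+ a))) (sym (ℤₚ.*-identityʳ (ℤ.+ b)))))))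
  (fromℚᵘ-+ (mkℚᵘ (ℤ.+ a) 0) (mkℚᵘ (ℤ.+ b) 0))

fromℕ-* : ∀ a b → fromℕ (a ℕ.* b) ≡ fromℕ a * fromℕ b
fromℕ-* a b = trans
  (fromℚᵘ-cong {mkℚᵘ (ℤ.+ (a ℕ.* b)) 0} {mkℚᵘ (ℤ.+ a) 0 ℚᵘ.* mkℚᵘ (ℤ.+ b) 0}
    (*≡* (cong (ℤ._* ℤ.+ 1) (ℤₚ.pos-* a b))))
  (fromℚᵘ-* (mkℚᵘ (ℤ.+ a) 0) (mkℚᵘ (ℤ.+ b) 0))

fromℕ-*-/ : ∀ a n → fromℕ (suc n) * (ℤ.+ a / suc n) ≡ fromℕ a
fromℕ-*-/ a n = trans (sym (fromℚᵘ-* (mkℚᵘ (ℤ.+ suc n) 0) (mkℚᵘ (ℤ.+ a) n)))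
  (fromℚᵘ-cong {mkℚᵘ (ℤ.+ suc n) 0 ℚᵘ.* mkℚᵘ (ℤ.+ a) n} {mkℚᵘ (ℤ.+ a) 0}
    (*≡* (begin
      ℤ.+ suc n ℤ.* ℤ.+ a ℤ.* ℤ.+ 1    ≡⟨ ℤₚ.*-identityʳ (ℤ.+ suc n ℤ.* ℤ.+ a) ⟩
      ℤ.+ suc n ℤ.* ℤ.+ a            ≡⟨ ℤₚ.*-comm (ℤ.+ suc n) (ℤ.+ a) ⟩
      ℤ.+ a ℤ.* ℤ.+ suc n            ≡⟨ cong (λ x → ℤ.+ a ℤ.* ℤ.+ x) (sym (ℕₚ.*-identityˡ (suc n))) ⟩
      ℤ.+ a ℤ.* ℤ.+ (1 ℕ.* suc n)    ∎)))

recip : ℕ → ℚ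
recip n = ℤ.+ 1 / suc n

fromℕ-*-recip : ∀ n → fromℕ (suc n) * recip n ≡ 1ℚ
fromℕ-*-recip n = fromℕ-*-/ 1 n

*-cancelˡ-suc : ∀ n {x y} → fromℕ (suc n) * x ≡ fromℕ (suc n) * y → x ≡ y
*-cancelˡ-suc n {x} {y} eq = trans (sym (undo x)) (trans (cong (recip n *_) eq) (undo y))
  where
  undo : ∀ z → recip n * (fromℕ (suc n) * z) ≡ z
  undo z = begin
    recip n * (fromℕ (suc n) * z)  ≡⟨ regroup (recip n) (fromℕ (suc n)) z ⟩
    fromℕ (suc n) * recip n * z    ≡⟨ cong (_* z) (fromℕ-*-recip n) ⟩
    1ℚ * z                         ≡⟨ *-identityˡ z ⟩
    z                              ∎
    where
    regroup : ∀ a b c → a * (b * c) ≡ b * a * c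
    regroup = Solver.solve-∀ ℚ-ring

-- Catalan numbers and their convolution

centralBinomial : ℕ → ℕ
centralBinomial n = (2 ℕ.* n) C n

centralBinomial-! : ∀ n → centralBinomial n ℕ.* (n ! ℕ.* n !) ≡ (2 ℕ.* n) !
centralBinomial-! n = begin
  centralBinomial n ℕ.* (n ! ℕ.* n !)
    ≡⟨ cong (λ x → centralBinomial n ℕ.* (n ! ℕ.* x !)) (sym 2n∸n≡n) ⟩
  centralBinomial n ℕ.* d
    ≡⟨ cong (ℕ._* d) (nCk≡n!/k![n-k]! n≤2n) ⟩
  ((2 ℕ.* n) ! ℕ./ d) ℕ.* d
    ≡⟨ ℕ÷.m/n*n≡m (k![n∸k]!∣n! n≤2n) ⟩
  (2 ℕ.* n) ! ∎
  where
  d = n ! ℕ.* (2 ℕ.* n ∸ n) !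
  instance d≢0 = ℕₚ.m*n≢0 (n !) ((2 ℕ.* n ∸ n) !) {{n ℕₚ.!≢0}} {{(2 ℕ.* n ∸ n) ℕₚ.!≢0}}
  n≤2n : n ≤ 2 ℕ.* n
  n≤2n = ℕₚ.m≤m+n n (n ℕ.+ 0)
  2n∸n≡n : 2 ℕ.* n ∸ n ≡ n
  2n∸n≡n = trans (ℕₚ.m+n∸m≡n n (n ℕ.+ 0)) (ℕₚ.+-identityʳ n)

-- Multiplied by (n + 1)(n!)², both sides become (2n + 2)!, which removes the division hidden in
-- `_C_`.
centralBinomial-suc : ∀ n →
  suc n ℕ.* centralBinomial (suc n) ≡ 2 ℕ.* (2 ℕ.* n ℕ.+ 1) ℕ.* centralBinomial n
centralBinomial-suc n = ℕₚ.*-cancelʳ-≡ _ _ d {{d≢0}} (begin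
  suc n ℕ.* b′ ℕ.* d
    ≡⟨ regroup n b′ (n !) ⟩
  b′ ℕ.* (suc n ! ℕ.* suc n !)
    ≡⟨ centralBinomial-! (suc n) ⟩
  (2 ℕ.* suc n) !
    ≡⟨ cong _! (double-suc n) ⟩
  suc (suc (2 ℕ.* n)) ℕ.* (suc (2 ℕ.* n) ℕ.* (2 ℕ.* n) !)
    ≡⟨ cong (λ x → suc (suc (2 ℕ.* n)) ℕ.* (suc (2 ℕ.* n) ℕ.* x)) (sym (centralBinomial-! n)) ⟩
  suc (suc (2 ℕ.* n)) ℕ.* (suc (2 ℕ.* n) ℕ.* (b ℕ.* (n ! ℕ.* n !)))
    ≡⟨ regroup′ n b (n !) ⟩
  2 ℕ.* (2 ℕ.* n ℕ.+ 1) ℕ.* b ℕ.* d ∎)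
  where
  b b′ d : ℕ
  b  = centralBinomial n
  b′ = centralBinomial (suc n)
  d  = suc n ℕ.* (n ! ℕ.* n !)
  d≢0 : ℕ.NonZero d
  d≢0 = ℕₚ.m*n≢0 (suc n) (n ! ℕ.* n !) {{_}} {{ℕₚ.m*n≢0 (n !) (n !) {{n ℕₚ.!≢0}} {{n ℕₚ.!≢0}}}}
  double-suc : ∀ n → 2 ℕ.* suc n ≡ suc (suc (2 ℕ.* n))
  double-suc = ℕ-Solver.solve-∀
  regroup : ∀ n b f → suc n ℕ.* b ℕ.* (suc n ℕ.* (f ℕ.* f)) ≡ b ℕ.* ((suc n ℕ.* f) ℕ.* (suc n ℕ.* f))
  regroup = ℕ-Solver.solve-∀
  regroup′ : ∀ n b f → suc (suc (2 ℕ.* n)) ℕ.* (suc (2 ℕ.* n) ℕ.* (b ℕ.* (f ℕ.* f)))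
    ≡ 2 ℕ.* (2 ℕ.* n ℕ.+ 1) ℕ.* b ℕ.* (suc n ℕ.* (f ℕ.* f))
  regroup′ = ℕ-Solver.solve-∀

Cat : ℕ → ℚ
Cat n = catalan (ℤ.+ n)

Cat-centralBinomial : ∀ n → fromℕ (suc n) * Cat n ≡ fromℕ (centralBinomial n)
Cat-centralBinomial n = fromℕ-*-/ (centralBinomial n) n

Cat-suc : ∀ n → fromℕ (suc (suc n)) * Cat (suc n) ≡ fromℕ (2 ℕ.* (2 ℕ.* n ℕ.+ 1)) * Cat n
Cat-suc n = *-cancelˡ-suc n (begin
  fromℕ (suc n) * (fromℕ (suc (suc n)) * Cat (suc n))
    ≡⟨ cong (fromℕ (suc n) *_) (Cat-centralBinomial (suc n)) ⟩
  fromℕ (suc n) * fromℕ (centralBinomial (suc n))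
    ≡⟨ sym (fromℕ-* (suc n) (centralBinomial (suc n))) ⟩
  fromℕ (suc n ℕ.* centralBinomial (suc n))
    ≡⟨ cong fromℕ (centralBinomial-suc n) ⟩
  fromℕ (2 ℕ.* (2 ℕ.* n ℕ.+ 1) ℕ.* centralBinomial n)
    ≡⟨ fromℕ-* (2 ℕ.* (2 ℕ.* n ℕ.+ 1)) (centralBinomial n) ⟩
  c * fromℕ (centralBinomial n)
    ≡⟨ cong (c *_) (sym (Cat-centralBinomial n)) ⟩
  c * (fromℕ (suc n) * Cat n)
    ≡⟨ swap c (fromℕ (suc n)) (Cat n) ⟩
  fromℕ (suc n) * (c * Cat n) ∎)
  where
  c : ℚ
  c = fromℕ (2 ℕ.* (2 ℕ.* n ℕ.+ 1))
  swap : ∀ a b d → a * (b * d) ≡ b * (a * d)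
  swap = Solver.solve-∀ ℚ-ring

fromℕ-suc : ∀ n → fromℕ (suc n) ≡ 1ℚ + fromℕ n
fromℕ-suc n = fromℕ-+ 1 n

-- conv f n is the sum of f k C_{n-k} over k ≤ n.
conv : (ℕ → ℚ) → ℕ → ℚ
conv f zero    = f zero * Cat zero
conv f (suc n) = f zero * Cat (suc n) + conv (f ∘ suc) n

conv-cong : ∀ n {f g : ℕ → ℚ} → (∀ k → k ≤ n → f k ≡ g k) → conv f n ≡ conv g n
conv-cong zero    eq = cong (_* Cat 0) (eq 0 z≤n)
conv-cong (suc n) eq = cong₂ _+_ (cong (_* Cat (suc n)) (eq 0 z≤n))
  (conv-cong n (λ k k≤n → eq (suc k) (s≤s k≤n)))

conv-zero : ∀ n → conv (λ _ → 0ℚ) n ≡ 0ℚ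
conv-zero zero    = *-zeroˡ (Cat 0)
conv-zero (suc n) = cong₂ _+_ (*-zeroˡ (Cat (suc n))) (conv-zero n)

conv-+ : ∀ n (f g : ℕ → ℚ) → conv (λ k → f k + g k) n ≡ conv f n + conv g n
conv-+ zero    f g = *-distribʳ-+ (Cat 0) (f 0) (g 0)
conv-+ (suc n) f g = trans
  (cong ((f 0 + g 0) * Cat (suc n) +_) (conv-+ n (f ∘ suc) (g ∘ suc)))
  (interchange (f 0) (g 0) (Cat (suc n)) (conv (f ∘ suc) n) (conv (g ∘ suc) n))
  where
  interchange : ∀ a b c x y → (a + b) * c + (x + y) ≡ (a * c + x) + (b * c + y)
  interchange = Solver.solve-∀ ℚ-ring

conv-* : ∀ n x (f : ℕ → ℚ) → conv (λ k → x * f k) n ≡ x * conv f n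
conv-* zero    x f = *-assoc x (f 0) (Cat 0)
conv-* (suc n) x f = trans
  (cong (x * f 0 * Cat (suc n) +_) (conv-* n x (f ∘ suc)))
  (factor (f 0) (Cat (suc n)) x (conv (f ∘ suc) n))
  where
  factor : ∀ a c x y → x * a * c + x * y ≡ x * (a * c + y)
  factor = Solver.solve-∀ ℚ-ring

Cat-suc-ℚ : ∀ n → (1ℚ + (1ℚ + fromℕ n)) * Cat (suc n)
  ≡ (1ℚ + 1ℚ) * ((1ℚ + 1ℚ) * fromℕ n + 1ℚ) * Cat n
Cat-suc-ℚ n = begin
  (1ℚ + (1ℚ + fromℕ n)) * Cat (suc n)
    ≡⟨ cong (λ x → x * Cat (suc n)) (sym (trans (fromℕ-suc (suc n)) (cong (λ x → 1ℚ + x) (fromℕ-suc n)))) ⟩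
  fromℕ (suc (suc n)) * Cat (suc n)
    ≡⟨ Cat-suc n ⟩
  fromℕ (2 ℕ.* (2 ℕ.* n ℕ.+ 1)) * Cat n
    ≡⟨ cong (λ x → x * Cat n) (trans (fromℕ-* 2 (2 ℕ.* n ℕ.+ 1))
         (cong (λ x → (1ℚ + 1ℚ) * x) (trans (fromℕ-+ (2 ℕ.* n) 1) (cong (λ x → x + 1ℚ) (fromℕ-* 2 n))))) ⟩
  (1ℚ + 1ℚ) * ((1ℚ + 1ℚ) * fromℕ n + 1ℚ) * Cat n ∎

-- Gosper's certificate: gosper-step makes the convolution sum telescope after scaling by a factor that
-- depends on i + j only.
gosper : ℕ → ℕ → ℚ
gosper i j = (1ℚ + fromℕ i) * (1ℚ + fromℕ j) * (fromℕ i - fromℕ j) * (Cat i * Cat j)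

gosper-weight : ℚ → ℚ
gosper-weight s = (1ℚ + 1ℚ) * ((1ℚ + s) * (1ℚ + (1ℚ + s)))

gosper-step : ∀ i j →
  gosper-weight (fromℕ i + fromℕ j) * (Cat i * Cat j) ≡ gosper (suc i) j - gosper i (suc j)
gosper-step i j = sym (begin
  gosper (suc i) j - gosper i (suc j)
    ≡⟨ cong₂ (λ x y → (1ℚ + x) * (1ℚ + J) * (x - J) * (c′ * d) - (1ℚ + I) * (1ℚ + y) * (I - y) * (c * d′))
         (fromℕ-suc i) (fromℕ-suc j) ⟩
  (1ℚ + (1ℚ + I)) * (1ℚ + J) * (1ℚ + I - J) * (c′ * d) - (1ℚ + I) * (1ℚ + (1ℚ + J)) * (I - (1ℚ + J)) * (c * d′)
    ≡⟨ regroup I J c d c′ d′ ⟩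
  (1ℚ + (1ℚ + I)) * c′ * ((1ℚ + J) * (1ℚ + I - J) * d) - (1ℚ + (1ℚ + J)) * d′ * ((1ℚ + I) * (I - (1ℚ + J)) * c)
    ≡⟨ cong₂ (λ x y → x * ((1ℚ + J) * (1ℚ + I - J) * d) - y * ((1ℚ + I) * (I - (1ℚ + J)) * c))
         (Cat-suc-ℚ i) (Cat-suc-ℚ j) ⟩
  (1ℚ + 1ℚ) * ((1ℚ + 1ℚ) * I + 1ℚ) * c * ((1ℚ + J) * (1ℚ + I - J) * d)
    - (1ℚ + 1ℚ) * ((1ℚ + 1ℚ) * J + 1ℚ) * d * ((1ℚ + I) * (I - (1ℚ + J)) * c)
    ≡⟨ collect I J c d ⟩
  gosper-weight (I + J) * (c * d) ∎)
  where
  I J c c′ d d′ : ℚ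
  I = fromℕ i
  J = fromℕ j
  c = Cat i
  c′ = Cat (suc i)
  d = Cat j
  d′ = Cat (suc j)
  regroup : ∀ I J c d c′ d′ →
    (1ℚ + (1ℚ + I)) * (1ℚ + J) * (1ℚ + I - J) * (c′ * d) - (1ℚ + I) * (1ℚ + (1ℚ + J)) * (I - (1ℚ + J)) * (c * d′)
    ≡ (1ℚ + (1ℚ + I)) * c′ * ((1ℚ + J) * (1ℚ + I - J) * d) - (1ℚ + (1ℚ + J)) * d′ * ((1ℚ + I) * (I - (1ℚ + J)) * c)
  regroup = Solver.solve-∀ ℚ-ring
  collect : ∀ I J c d →
    (1ℚ + 1ℚ) * ((1ℚ + 1ℚ) * I + 1ℚ) * c * ((1ℚ + J) * (1ℚ + I - J) * d)
      - (1ℚ + 1ℚ) * ((1ℚ + 1ℚ) * J + 1ℚ) * d * ((1ℚ + I) * (I - (1ℚ + J)) * c)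
    ≡ (1ℚ + 1ℚ) * ((1ℚ + (I + J)) * (1ℚ + (1ℚ + (I + J)))) * (c * d)
  collect = Solver.solve-∀ ℚ-ring

-- The offset `a` is forced by `conv`, whose recursion shifts `f`. Passing from (a, n + 1) to (a +
-- 1, n) keeps a + n, so one weight serves the whole sum and only the two boundary values survive.
conv-gosper : ∀ n a → gosper-weight (fromℕ a + fromℕ n) * conv (λ k → Cat (a ℕ.+ k)) n
  ≡ gosper (suc (a ℕ.+ n)) 0 - gosper a (suc n)
conv-gosper zero a = subst
  (λ x → gosper-weight (fromℕ a + fromℕ 0) * (Cat x * Cat 0) ≡ gosper (suc x) 0 - gosper a 1)
  (sym (ℕₚ.+-identityʳ a)) (gosper-step a 0)
conv-gosper (suc n) a = begin
  w * (Cat (a ℕ.+ 0) * Cat (suc n) + conv (λ k → Cat (a ℕ.+ suc k)) n)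
    ≡⟨ cong₂ (λ x y → w * (Cat x * Cat (suc n) + y)) (ℕₚ.+-identityʳ a)
         (conv-cong n (λ k _ → cong Cat (ℕₚ.+-suc a k))) ⟩
  w * (Cat a * Cat (suc n) + conv (λ k → Cat (suc a ℕ.+ k)) n)
    ≡⟨ *-distribˡ-+ w (Cat a * Cat (suc n)) (conv (λ k → Cat (suc a ℕ.+ k)) n) ⟩
  w * (Cat a * Cat (suc n)) + w * conv (λ k → Cat (suc a ℕ.+ k)) n
    ≡⟨ cong₂ _+_ (gosper-step a (suc n))
         (trans (cong (λ x → gosper-weight x * conv (λ k → Cat (suc a ℕ.+ k)) n) shift)
           (conv-gosper n (suc a))) ⟩
  (gosper (suc a) (suc n) - gosper a (suc (suc n)))
    + (gosper (suc (suc a ℕ.+ n)) 0 - gosper (suc a) (suc n))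
    ≡⟨ telescope (gosper (suc a) (suc n)) (gosper a (suc (suc n))) (gosper (suc (suc a ℕ.+ n)) 0) ⟩
  gosper (suc (suc a ℕ.+ n)) 0 - gosper a (suc (suc n))
    ≡⟨ cong (λ x → gosper (suc x) 0 - gosper a (suc (suc n))) (sym (ℕₚ.+-suc a n)) ⟩
  gosper (suc (a ℕ.+ suc n)) 0 - gosper a (suc (suc n)) ∎
  where
  w : ℚ
  w = gosper-weight (fromℕ a + fromℕ (suc n))
  shift : fromℕ a + fromℕ (suc n) ≡ fromℕ (suc a) + fromℕ n
  shift = begin
    fromℕ a + fromℕ (suc n)  ≡⟨ sym (fromℕ-+ a (suc n)) ⟩
    fromℕ (a ℕ.+ suc n)      ≡⟨ cong fromℕ (ℕₚ.+-suc a n) ⟩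
    fromℕ (suc a ℕ.+ n)      ≡⟨ fromℕ-+ (suc a) n ⟩
    fromℕ (suc a) + fromℕ n  ∎
  telescope : ∀ x y z → (x - y) + (z - x) ≡ z - y
  telescope = Solver.solve-∀ ℚ-ring

-- Segner's recurrence. At offset 0 the two boundary values are opposite, so their difference is 2(n
-- + 1)(n + 2) C_(n+1); the weight 2(n + 1)(n + 2) then cancels factor by factor.
conv-Cat : ∀ n → conv Cat n ≡ Cat (suc n)
conv-Cat n = *-cancelˡ-suc 1 (*-cancelˡ-suc n (*-cancelˡ-suc (suc n) (begin
  fromℕ (suc (suc n)) * (fromℕ (suc n) * (fromℕ 2 * conv Cat n))
    ≡⟨ cong₂ (λ x y → x * (y * (fromℕ 2 * conv Cat n))) suc-suc (fromℕ-suc n) ⟩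
  (1ℚ + (1ℚ + N)) * ((1ℚ + N) * ((1ℚ + 1ℚ) * conv Cat n))
    ≡⟨ to-weight N (conv Cat n) ⟩
  (1ℚ + 1ℚ) * ((1ℚ + (0ℚ + N)) * (1ℚ + (1ℚ + (0ℚ + N)))) * conv Cat n
    ≡⟨ conv-gosper n 0 ⟩
  gosper (suc n) 0 - gosper 0 (suc n)
    ≡⟨ cong (λ x → (1ℚ + x) * (1ℚ + 0ℚ) * (x - 0ℚ) * (c * 1ℚ) - (1ℚ + 0ℚ) * (1ℚ + x) * (0ℚ - x) * (1ℚ * c))
         (fromℕ-suc n) ⟩
  (1ℚ + (1ℚ + N)) * (1ℚ + 0ℚ) * ((1ℚ + N) - 0ℚ) * (c * 1ℚ)
    - (1ℚ + 0ℚ) * (1ℚ + (1ℚ + N)) * (0ℚ - (1ℚ + N)) * (1ℚ * c)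
    ≡⟨ from-gosper N c ⟩
  (1ℚ + (1ℚ + N)) * ((1ℚ + N) * ((1ℚ + 1ℚ) * c))
    ≡⟨ sym (cong₂ (λ x y → x * (y * (fromℕ 2 * c))) suc-suc (fromℕ-suc n)) ⟩
  fromℕ (suc (suc n)) * (fromℕ (suc n) * (fromℕ 2 * c)) ∎)))
  where
  N c : ℚ
  N = fromℕ n
  c = Cat (suc n)
  suc-suc : fromℕ (suc (suc n)) ≡ 1ℚ + (1ℚ + N)
  suc-suc = trans (fromℕ-suc (suc n)) (cong (λ x → 1ℚ + x) (fromℕ-suc n))
  to-weight : ∀ N x → (1ℚ + (1ℚ + N)) * ((1ℚ + N) * ((1ℚ + 1ℚ) * x))
    ≡ (1ℚ + 1ℚ) * ((1ℚ + (0ℚ + N)) * (1ℚ + (1ℚ + (0ℚ + N)))) * x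
  to-weight = Solver.solve-∀ ℚ-ring
  from-gosper : ∀ N c → (1ℚ + (1ℚ + N)) * (1ℚ + 0ℚ) * ((1ℚ + N) - 0ℚ) * (c * 1ℚ)
    - (1ℚ + 0ℚ) * (1ℚ + (1ℚ + N)) * (0ℚ - (1ℚ + N)) * (1ℚ * c)
    ≡ (1ℚ + (1ℚ + N)) * ((1ℚ + N) * ((1ℚ + 1ℚ) * c))
  from-gosper = Solver.solve-∀ ℚ-ring

-- In generating functions: the Hankel array C_{k+c} has the series (x c(x) - y c(y))/(x - y), and c
-- = 1 + x c² turns its product with c(x) c(y) into (c(x) - c(y))/(x - y).
conv-conv-Cat : ∀ b i → conv (λ k → conv (λ c → Cat (k ℕ.+ c)) b) i ≡ Cat (suc (i ℕ.+ b))
conv-conv-Cat zero i = begin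
  conv (λ k → Cat (k ℕ.+ 0) * Cat 0) i  ≡⟨ conv-cong i (λ k _ → trans (*-identityʳ (Cat (k ℕ.+ 0))) (cong Cat (ℕₚ.+-identityʳ k))) ⟩
  conv Cat i                            ≡⟨ conv-Cat i ⟩
  Cat (suc i)                           ≡⟨ cong (Cat ∘ suc) (sym (ℕₚ.+-identityʳ i)) ⟩
  Cat (suc (i ℕ.+ 0))                   ∎
-- The term added on both sides is, by `conv-Cat`, the term k = 0 of `conv W (suc i)`; completing
-- that sum lets the induction hypothesis apply at i + 1.
conv-conv-Cat (suc b) i = +-cancelˡ (Cat (suc b) * Cat (suc i)) _ _ (begin
  Cat (suc b) * Cat (suc i) + conv (λ k → Cat (k ℕ.+ 0) * Cat (suc b) + conv (λ c → Cat (k ℕ.+ suc c)) b) i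
    ≡⟨ cong (Cat (suc b) * Cat (suc i) +_) (conv-cong i (λ k _ → cong₂ _+_
         (trans (cong (λ x → Cat x * Cat (suc b)) (ℕₚ.+-identityʳ k)) (*-comm (Cat k) (Cat (suc b))))
         (conv-cong b (λ c _ → cong Cat (ℕₚ.+-suc k c))))) ⟩
  Cat (suc b) * Cat (suc i) + conv (λ k → Cat (suc b) * Cat k + W (suc k)) i
    ≡⟨ cong (Cat (suc b) * Cat (suc i) +_) (trans (conv-+ i (λ k → Cat (suc b) * Cat k) (W ∘ suc))
         (cong (_+ conv (W ∘ suc) i) (trans (conv-* i (Cat (suc b)) Cat) (cong (Cat (suc b) *_) (conv-Cat i))))) ⟩
  Cat (suc b) * Cat (suc i) + (Cat (suc b) * Cat (suc i) + conv (W ∘ suc) i)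
    ≡⟨ cong (λ x → Cat (suc b) * Cat (suc i) + (x * Cat (suc i) + conv (W ∘ suc) i)) (sym (conv-Cat b)) ⟩
  Cat (suc b) * Cat (suc i) + conv W (suc i)
    ≡⟨ cong (Cat (suc b) * Cat (suc i) +_) (conv-conv-Cat b (suc i)) ⟩
  Cat (suc b) * Cat (suc i) + Cat (suc (suc i ℕ.+ b))
    ≡⟨ cong (λ x → Cat (suc b) * Cat (suc i) + Cat (suc x)) (sym (ℕₚ.+-suc i b)) ⟩
  Cat (suc b) * Cat (suc i) + Cat (suc (i ℕ.+ suc b)) ∎)
  where
  W : ℕ → ℚ
  W k = conv (λ c → Cat (k ℕ.+ c)) b
  +-cancelˡ : ∀ x y z → x + y ≡ x + z → y ≡ z
  +-cancelˡ x y z eq = trans (undo x y) (trans (cong (_- x) eq) (sym (undo x z)))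
    where
    undo : ∀ x y → y ≡ x + y - x
    undo = Solver.solve-∀ ℚ-ring

-- Determinants

sum-zero : ∀ {n} (f : Fin n → ℚ) → (∀ i → f i ≡ 0ℚ) → sum f ≡ 0ℚ
sum-zero {n} f eq = trans (sum-cong-≗ eq) (sum-replicate-zero n)

sum-linear : ∀ {n} x y (f g : Fin n → ℚ) →
  sum (λ i → x * f i + y * g i) ≡ x * sum f + y * sum g
sum-linear x y f g = trans (∑-distrib-+ (λ i → x * f i) (λ i → y * g i))
  (sym (cong₂ _+_ (*-distribˡ-sum x f) (*-distribˡ-sum y g)))

sgn : ℕ → ℚ
sgn k = (- 1ℚ) ^ k

det-cong : ∀ n {A B : Matrix n} → (∀ i j → A i j ≡ B i j) → det n A ≡ det n B
det-cong zero    eq = refl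
det-cong (suc n) eq = sum-cong-≗ λ j → cong₂ (λ x y → sgn (toℕ j) * x * y) (eq zero j)
  (det-cong n (λ r c → eq (suc r) (punchIn j c)))

-- The column choices met below are composites of `punchIn` that agree pointwise but not
-- definitionally.
Extensional : ∀ {n m} → ((Fin n → Fin m) → ℚ) → Set
Extensional F = ∀ {φ ψ} → (∀ c → φ c ≡ ψ c) → F φ ≡ F ψ

-- Laplace expansion along two rows a and b; F φ stands for the minor on the columns φ.
twoRows : ∀ n (a b : Fin (suc (suc n)) → ℚ) → ((Fin n → Fin (suc (suc n))) → ℚ) → ℚ
twoRows n a b F = sum λ j → sgn (toℕ j) * a j *
  sum λ k → sgn (toℕ k) * b (punchIn j k) * F (λ c → punchIn j (punchIn k c))

twoRows-tail : ∀ n (a b : Fin (suc (suc n)) → ℚ) → ((Fin n → Fin (suc (suc n))) → ℚ) → ℚ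
twoRows-tail n a b F = sum λ j → sgn (toℕ j) * a (suc j) *
  sum λ k → sgn (toℕ k) * b (suc (punchIn j k)) * F (λ c → punchIn (suc j) (punchIn (suc k) c))

twoRows-head : ∀ n (a : Fin (suc (suc n)) → ℚ) → ((Fin n → Fin (suc (suc n))) → ℚ) → ℚ
twoRows-head n a F = sum λ k → sgn (toℕ k) * a (suc k) * F (λ c → suc (punchIn k c))

-- The terms are sorted by which row takes column zero: a, b or neither. If b takes it, only j is
-- shifted, hence the minus sign; if neither does, both indices are shifted and the two signs
-- cancel.
twoRows-split : ∀ n a b F → twoRows n a b F
  ≡ 1ℚ * a zero * twoRows-head n b F + (- b zero * twoRows-head n a F + 1ℚ * twoRows-tail n a b F)
twoRows-split n a b F = cong (1ℚ * a zero * twoRows-head n b F +_) (trans (sum-cong-≗ split-term)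
  (sum-linear (- b zero) 1ℚ (λ j → sgn (toℕ j) * a (suc j) * F (λ c → suc (punchIn j c)))
    (λ j → sgn (toℕ j) * a (suc j) * inner j)))
  where
  inner : Fin (suc n) → ℚ
  inner j = sum λ k → sgn (toℕ k) * b (suc (punchIn j k)) * F (λ c → punchIn (suc j) (punchIn (suc k) c))
  negate : ∀ s x y → - 1ℚ * s * x * y ≡ - 1ℚ * (s * x * y)
  negate = Solver.solve-∀ ℚ-ring
  collect : ∀ s a b f x → - 1ℚ * s * a * (1ℚ * b * f + - 1ℚ * x) ≡ - b * (s * a * f) + 1ℚ * (s * a * x)
  collect = Solver.solve-∀ ℚ-ring
  split-term : ∀ j → - 1ℚ * sgn (toℕ j) * a (suc j)
      * (1ℚ * b zero * F (λ c → suc (punchIn j c)) + sum λ k → - 1ℚ * sgn (toℕ k) * b (suc (punchIn j k))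
          * F (λ c → punchIn (suc j) (punchIn (suc k) c)))
    ≡ - b zero * (sgn (toℕ j) * a (suc j) * F (λ c → suc (punchIn j c))) + 1ℚ * (sgn (toℕ j) * a (suc j) * inner j)
  split-term j = trans
    (cong (λ x → - 1ℚ * sgn (toℕ j) * a (suc j) * (1ℚ * b zero * F (λ c → suc (punchIn j c)) + x))
      (trans (sum-cong-≗ (λ k → negate (sgn (toℕ k)) (b (suc (punchIn j k))) (F (λ c → punchIn (suc j) (punchIn (suc k) c)))))
        (sym (*-distribˡ-sum (- 1ℚ) (λ k → sgn (toℕ k) * b (suc (punchIn j k)) * F (λ c → punchIn (suc j) (punchIn (suc k) c)))))))
    (collect (sgn (toℕ j)) (a (suc j)) (b zero) (F (λ c → suc (punchIn j c))) (inner j))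

-- Mutual with `twoRows-swap`: the tail is again a two-row expansion, over the columns other than
-- zero, and `F ∘ Fin.lift 1` hands column zero to the minor. The swap itself exchanges the two head
-- terms.
twoRows-tail-swap : ∀ n a b (F : (Fin n → Fin (suc (suc n))) → ℚ) → Extensional F →
  twoRows-tail n a b F ≡ - twoRows-tail n b a F
twoRows-swap : ∀ n a b (F : (Fin n → Fin (suc (suc n))) → ℚ) → Extensional F →
  twoRows n a b F ≡ - twoRows n b a F

twoRows-tail-swap zero a b F ext = trans (vanish (a (suc zero))) (cong -_ (sym (vanish (b (suc zero)))))
  where
  vanish : ∀ x → 1ℚ * x * 0ℚ + 0ℚ ≡ 0ℚ
  vanish = Solver.solve-∀ ℚ-ring
twoRows-tail-swap (suc n) a b F ext = begin
  twoRows-tail (suc n) a b F                              ≡⟨ as-lift a b ⟩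
  twoRows n (a ∘ suc) (b ∘ suc) (F ∘ Fin.lift 1)          ≡⟨ twoRows-swap n (a ∘ suc) (b ∘ suc) (F ∘ Fin.lift 1) (λ eq → ext (lift-cong eq)) ⟩
  - twoRows n (b ∘ suc) (a ∘ suc) (F ∘ Fin.lift 1)        ≡⟨ cong -_ (sym (as-lift b a)) ⟩
  - twoRows-tail (suc n) b a F                            ∎
  where
  lift-cong : ∀ {k l} {φ ψ : Fin k → Fin l} → (∀ c → φ c ≡ ψ c) → ∀ c → Fin.lift 1 φ c ≡ Fin.lift 1 ψ c
  lift-cong eq zero    = refl
  lift-cong eq (suc c) = cong suc (eq c)
  punchIn-lift : ∀ (j : Fin (suc (suc n))) (k : Fin (suc n)) c → punchIn (suc j) (punchIn (suc k) c)
    ≡ Fin.lift 1 (λ d → punchIn j (punchIn k d)) c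
  punchIn-lift j k zero    = refl
  punchIn-lift j k (suc c) = refl
  as-lift : ∀ a b → twoRows-tail (suc n) a b F ≡ twoRows n (a ∘ suc) (b ∘ suc) (F ∘ Fin.lift 1)
  as-lift a b = sum-cong-≗ λ j → cong (sgn (toℕ j) * a (suc j) *_) (sum-cong-≗ λ k →
    cong (sgn (toℕ k) * b (suc (punchIn j k)) *_) (ext (punchIn-lift j k)))

twoRows-swap n a b F ext = begin
  twoRows n a b F
    ≡⟨ twoRows-split n a b F ⟩
  1ℚ * a zero * twoRows-head n b F + (- b zero * twoRows-head n a F + 1ℚ * twoRows-tail n a b F)
    ≡⟨ cong (λ x → 1ℚ * a zero * twoRows-head n b F + (- b zero * twoRows-head n a F + 1ℚ * x)) (twoRows-tail-swap n a b F ext) ⟩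
  1ℚ * a zero * twoRows-head n b F + (- b zero * twoRows-head n a F + 1ℚ * - twoRows-tail n b a F)
    ≡⟨ regroup (a zero) (b zero) (twoRows-head n a F) (twoRows-head n b F) (twoRows-tail n b a F) ⟩
  - (1ℚ * b zero * twoRows-head n a F + (- a zero * twoRows-head n b F + 1ℚ * twoRows-tail n b a F))
    ≡⟨ cong -_ (sym (twoRows-split n b a F)) ⟩
  - twoRows n b a F ∎
  where
  regroup : ∀ a b x y z → 1ℚ * a * y + (- b * x + 1ℚ * - z) ≡ - (1ℚ * b * x + (- a * y + 1ℚ * z))
  regroup = Solver.solve-∀ ℚ-ring

det-swap : ∀ n a b (R : Fin n → Fin (suc (suc n)) → ℚ) →
  det (suc (suc n)) (a ∷ b ∷ R) ≡ - det (suc (suc n)) (b ∷ a ∷ R)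
det-swap n a b R = twoRows-swap n a b (λ φ → det n (λ r c → R r (φ c)))
  (λ eq → det-cong n (λ r c → cong (R r) (eq c)))

-- Turns antisymmetry under `det-swap` into the vanishing of a determinant with two equal rows.
x≡-x⇒x≡0 : ∀ {x} → x ≡ - x → x ≡ 0ℚ
x≡-x⇒x≡0 {x} eq = *-cancelˡ-suc 1 (begin
  (1ℚ + 1ℚ) * x  ≡⟨ double x ⟩
  x - - x        ≡⟨ cong (λ y → x - y) (sym eq) ⟩
  x - x          ≡⟨ +-inverseʳ x ⟩
  0ℚ             ≡⟨ sym (*-zeroʳ (1ℚ + 1ℚ)) ⟩
  (1ℚ + 1ℚ) * 0ℚ ∎)
  where
  double : ∀ x → (1ℚ + 1ℚ) * x ≡ x - - x
  double = Solver.solve-∀ ℚ-ring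

det-head-linear : ∀ n l b a (R : Fin n → Fin (suc n) → ℚ) →
  det (suc n) ((λ c → b c + l * a c) ∷ R) ≡ 1ℚ * det (suc n) (b ∷ R) + l * det (suc n) (a ∷ R)
det-head-linear n l b a R = trans
  (sum-cong-≗ λ j → expand (sgn (toℕ j)) (b j) l (a j) (det n (λ r c → R r (punchIn j c))))
  (sum-linear 1ℚ l (λ j → sgn (toℕ j) * b j * det n (λ r c → R r (punchIn j c)))
    (λ j → sgn (toℕ j) * a j * det n (λ r c → R r (punchIn j c))))
  where
  expand : ∀ s b l a d → s * (b + l * a) * d ≡ 1ℚ * (s * b * d) + l * (s * a * d)
  expand = Solver.solve-∀ ℚ-ring

-- Swapping brings the first modified row to the top, where linearity splits it into b and a
-- multiple of a; the latter repeats a and contributes zero. In the minors along b the row a is the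
-- head again, so induction clears the remaining rows.
det-add-head : ∀ n (l : Fin n → ℚ) (a : Fin (suc n) → ℚ) (R : Fin n → Fin (suc n) → ℚ) →
  det (suc n) (a ∷ (λ r c → R r c + l r * a c)) ≡ det (suc n) (a ∷ R)
det-add-head zero    l a R = refl
det-add-head (suc n) l a R = begin
  det (suc (suc n)) (a ∷ (λ r c → R r c + l r * a c))
    ≡⟨ det-cong (suc (suc n)) split-rows ⟩
  det (suc (suc n)) (a ∷ (λ c → b c + l zero * a c) ∷ R″)
    ≡⟨ det-swap n a (λ c → b c + l zero * a c) R″ ⟩
  - det (suc (suc n)) ((λ c → b c + l zero * a c) ∷ a ∷ R″)
    ≡⟨ cong -_ (det-head-linear (suc n) (l zero) b a (a ∷ R″)) ⟩
  - (1ℚ * det (suc (suc n)) (b ∷ a ∷ R″) + l zero * det (suc (suc n)) (a ∷ a ∷ R″))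
    ≡⟨ cong (λ x → - (1ℚ * det (suc (suc n)) (b ∷ a ∷ R″) + l zero * x)) (x≡-x⇒x≡0 (det-swap n a a R″)) ⟩
  - (1ℚ * det (suc (suc n)) (b ∷ a ∷ R″) + l zero * 0ℚ)
    ≡⟨ simplify (det (suc (suc n)) (b ∷ a ∷ R″)) (l zero) ⟩
  - det (suc (suc n)) (b ∷ a ∷ R″)
    ≡⟨ cong -_ (sum-cong-≗ λ j → cong (sgn (toℕ j) * b j *_) (minor j)) ⟩
  - det (suc (suc n)) (b ∷ a ∷ R′)
    ≡⟨ sym (det-swap n a b R′) ⟩
  det (suc (suc n)) (a ∷ b ∷ R′)
    ≡⟨ det-cong (suc (suc n)) unsplit-rows ⟩
  det (suc (suc n)) (a ∷ R) ∎
  where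
  b : Fin (suc (suc n)) → ℚ
  b = R zero
  R′ R″ : Fin n → Fin (suc (suc n)) → ℚ
  R′ = R ∘ suc
  R″ r c = R (suc r) c + l (suc r) * a c
  split-rows : ∀ i j → (a ∷ (λ r c → R r c + l r * a c)) i j ≡ (a ∷ (λ c → b c + l zero * a c) ∷ R″) i j
  split-rows zero          j = refl
  split-rows (suc zero)    j = refl
  split-rows (suc (suc i)) j = refl
  unsplit-rows : ∀ i j → (a ∷ b ∷ R′) i j ≡ (a ∷ R) i j
  unsplit-rows zero          j = refl
  unsplit-rows (suc zero)    j = refl
  unsplit-rows (suc (suc i)) j = refl
  simplify : ∀ x y → - (1ℚ * x + y * 0ℚ) ≡ - x
  simplify = Solver.solve-∀ ℚ-ring
  minor : ∀ j → det (suc n) (λ r c → (a ∷ R″) r (punchIn j c)) ≡ det (suc n) (λ r c → (a ∷ R′) r (punchIn j c))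
  minor j = begin
    det (suc n) (λ r c → (a ∷ R″) r (punchIn j c))
      ≡⟨ det-cong (suc n) (restrict R″) ⟩
    det (suc n) ((a ∘ punchIn j) ∷ (λ r c → R″ r (punchIn j c)))
      ≡⟨ det-add-head n (l ∘ suc) (a ∘ punchIn j) (λ r c → R′ r (punchIn j c)) ⟩
    det (suc n) ((a ∘ punchIn j) ∷ (λ r c → R′ r (punchIn j c)))
      ≡⟨ sym (det-cong (suc n) (restrict R′)) ⟩
    det (suc n) (λ r c → (a ∷ R′) r (punchIn j c)) ∎
    where
    restrict : ∀ (S : Fin n → Fin (suc (suc n)) → ℚ) r c →
      (a ∷ S) r (punchIn j c) ≡ ((a ∘ punchIn j) ∷ (λ r c → S r (punchIn j c))) r c
    restrict S zero    c = refl
    restrict S (suc r) c = refl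

record LowerUnitriangular (L : ℕ → ℕ → ℚ) : Set where
  constructor lowerUnitriangular
  field
    diagonal : ∀ k → L k k ≡ 1ℚ
    above    : ∀ i k → i < k → L i k ≡ 0ℚ

open LowerUnitriangular

-- Column 0 of `L` only adds multiples of the first row of `A` to the rows below. Once it is
-- cleared, each minor along the first row is a product of the same kind, with `L` shifted by one.
det-lowerUnitriangular-* : ∀ n L → LowerUnitriangular L → (A : Matrix n) →
  det n (λ i j → sum λ k → L (toℕ i) (toℕ k) * A k j) ≡ det n A
det-lowerUnitriangular-* zero    L tri A = refl
det-lowerUnitriangular-* (suc n) L tri A = begin
  det (suc n) (λ i j → sum λ k → L (toℕ i) (toℕ k) * A k j)
    ≡⟨ det-cong (suc n) rows ⟩
  det (suc n) (A zero ∷ (λ r c → LA r c + L (suc (toℕ r)) 0 * A zero c))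
    ≡⟨ det-add-head n (λ r → L (suc (toℕ r)) 0) (A zero) LA ⟩
  det (suc n) (A zero ∷ LA)
    ≡⟨ (sum-cong-≗ λ j → cong (sgn (toℕ j) * A zero j *_)
         (det-lowerUnitriangular-* n (λ i k → L (suc i) (suc k)) tri′ (λ r c → A (suc r) (punchIn j c)))) ⟩
  det (suc n) A ∎
  where
  LA : Fin n → Fin (suc n) → ℚ
  LA r c = sum λ k → L (suc (toℕ r)) (suc (toℕ k)) * A (suc k) c
  tri′ : LowerUnitriangular (λ i k → L (suc i) (suc k))
  tri′ = lowerUnitriangular (λ k → diagonal tri (suc k)) (λ i k i<k → above tri (suc i) (suc k) (s≤s i<k))
  rows : ∀ i j → (sum λ k → L (toℕ i) (toℕ k) * A k j) ≡ (A zero ∷ (λ r c → LA r c + L (suc (toℕ r)) 0 * A zero c)) i j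
  rows zero j = begin
    L 0 0 * A zero j + (sum λ k → L 0 (suc (toℕ k)) * A (suc k) j)
      ≡⟨ cong₂ _+_ (trans (cong (_* A zero j) (diagonal tri 0)) (*-identityˡ (A zero j)))
           (sum-zero _ (λ k → trans (cong (_* A (suc k) j) (above tri 0 (suc (toℕ k)) (s≤s z≤n))) (*-zeroˡ (A (suc k) j)))) ⟩
    A zero j + 0ℚ
      ≡⟨ +-identityʳ (A zero j) ⟩
    A zero j ∎
  rows (suc i) j = +-comm (L (suc (toℕ i)) 0 * A zero j) (LA i j)

det-zeroColumn : ∀ n (A : Matrix (suc n)) → (∀ i → A i zero ≡ 0ℚ) → det (suc n) A ≡ 0ℚ
det-zeroColumn zero A eq = trans (cong (λ x → 1ℚ * x * 1ℚ + 0ℚ) (eq zero)) refl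
det-zeroColumn (suc n) A eq = sum-zero (λ j → sgn (toℕ j) * A zero j * det (suc n) (λ r c → A (suc r) (punchIn j c))) λ
  { zero    → trans (cong (λ x → 1ℚ * x * det (suc n) (λ r c → A (suc r) (suc c))) (eq zero))
                    (*-zeroˡ (det (suc n) (λ r c → A (suc r) (suc c))))
  ; (suc j) → trans (cong (sgn (suc (toℕ j)) * A zero (suc j) *_)
                      (det-zeroColumn n (λ r c → A (suc r) (punchIn (suc j) c)) (λ r → eq (suc r))))
                    (*-zeroʳ (sgn (suc (toℕ j)) * A zero (suc j)))
  }

-- A column expansion obtained from row expansions: if r is not the top row, the top entry of column
-- 0 is zero, and every other minor still has a column 0 with a single possibly nonzero entry, one
-- row higher.
det-singleColumn : ∀ n (A : Matrix (suc n)) r → (∀ i → A (punchIn r i) zero ≡ 0ℚ) →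
  det (suc n) A ≡ sgn (toℕ r) * A r zero * det n (λ i j → A (punchIn r i) (suc j))
det-singleColumn zero    A zero eq = +-identityʳ (1ℚ * A zero zero * 1ℚ)
det-singleColumn (suc n) A zero eq = trans
  (cong (1ℚ * A zero zero * det (suc n) (λ i j → A (suc i) (suc j)) +_)
    (sum-zero _ (λ j → trans (cong (sgn (suc (toℕ j)) * A zero (suc j) *_)
        (det-zeroColumn n (λ r c → A (suc r) (punchIn (suc j) c)) (λ i → eq i)))
      (*-zeroʳ (sgn (suc (toℕ j)) * A zero (suc j))))))
  (+-identityʳ (1ℚ * A zero zero * det (suc n) (λ i j → A (suc i) (suc j))))
det-singleColumn (suc n) A (suc r) eq = begin
  1ℚ * A zero zero * M + (sum λ j → - 1ℚ * sgn (toℕ j) * A zero (suc j) * det (suc n) (λ i c → A (suc i) (punchIn (suc j) c)))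
    ≡⟨ cong₂ _+_ (trans (cong (λ x → 1ℚ * x * M) (eq zero)) (*-zeroˡ M)) (sum-cong-≗ term) ⟩
  0ℚ + (sum λ j → sgn (suc (toℕ r)) * A (suc r) zero * (sgn (toℕ j) * A zero (suc j) * minor j))
    ≡⟨ +-identityˡ _ ⟩
  (sum λ j → sgn (suc (toℕ r)) * A (suc r) zero * (sgn (toℕ j) * A zero (suc j) * minor j))
    ≡⟨ sym (*-distribˡ-sum (sgn (suc (toℕ r)) * A (suc r) zero) (λ j → sgn (toℕ j) * A zero (suc j) * minor j)) ⟩
  sgn (suc (toℕ r)) * A (suc r) zero * det (suc n) (λ i j → A (punchIn (suc r) i) (suc j)) ∎
  where
  M : ℚ
  M = det (suc n) (λ i j → A (suc i) (suc j))
  minor : Fin (suc n) → ℚ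
  minor j = det n (λ i c → A (suc (punchIn r i)) (suc (punchIn j c)))
  regroup : ∀ s a t b m → - 1ℚ * s * a * (t * b * m) ≡ - 1ℚ * t * b * (s * a * m)
  regroup = Solver.solve-∀ ℚ-ring
  term : ∀ j → - 1ℚ * sgn (toℕ j) * A zero (suc j) * det (suc n) (λ i c → A (suc i) (punchIn (suc j) c))
    ≡ sgn (suc (toℕ r)) * A (suc r) zero * (sgn (toℕ j) * A zero (suc j) * minor j)
  term j = trans
    (cong (- 1ℚ * sgn (toℕ j) * A zero (suc j) *_)
      (det-singleColumn n (λ i c → A (suc i) (punchIn (suc j) c)) r (λ i → eq (suc i))))
    (regroup (sgn (toℕ j)) (A zero (suc j)) (sgn (toℕ r)) (A (suc r) zero) (minor j))

det-upperTriangular : ∀ n (V : ℕ → ℕ → ℚ) → (∀ k j → j < k → V k j ≡ 0ℚ) →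
  det n (λ i j → V (toℕ i) (toℕ j)) ≡ product {n} (λ k → V (toℕ k) (toℕ k))
det-upperTriangular zero    V below = refl
det-upperTriangular (suc n) V below = begin
  det (suc n) (λ i j → V (toℕ i) (toℕ j))
    ≡⟨ det-singleColumn n (λ i j → V (toℕ i) (toℕ j)) zero (λ i → below (suc (toℕ i)) 0 (s≤s z≤n)) ⟩
  1ℚ * V 0 0 * det n (λ i j → V (suc (toℕ i)) (suc (toℕ j)))
    ≡⟨ cong₂ _*_ (*-identityˡ (V 0 0))
         (det-upperTriangular n (λ k j → V (suc k) (suc j)) (λ k j j<k → below (suc k) (suc j) (s≤s j<k))) ⟩
  V 0 0 * product {n} (λ k → V (suc (toℕ k)) (suc (toℕ k))) ∎

-- An unbounded `punchIn`, so that deleting a row of an ℕ-indexed matrix leaves an ℕ-indexed matrix.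
skip : ℕ → ℕ → ℕ
skip zero    k       = suc k
skip (suc m) zero    = zero
skip (suc m) (suc k) = suc (skip m k)

toℕ-punchIn : ∀ {n} (i : Fin (suc n)) (j : Fin n) → toℕ (punchIn i j) ≡ skip (toℕ i) (toℕ j)
toℕ-punchIn zero    j       = refl
toℕ-punchIn (suc i) zero    = refl
toℕ-punchIn (suc i) (suc j) = cong suc (toℕ-punchIn i j)

δ : ℕ → ℕ → ℚ
δ zero    zero    = 1ℚ
δ zero    (suc _) = 0ℚ
δ (suc _) zero    = 0ℚ
δ (suc m) (suc n) = δ m n

δ-refl : ∀ m → δ m m ≡ 1ℚ
δ-refl zero    = refl
δ-refl (suc m) = δ-refl m

δ-skip : ∀ m k → δ (skip m k) m ≡ 0ℚ
δ-skip zero    k       = refl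
δ-skip (suc m) zero    = refl
δ-skip (suc m) (suc k) = δ-skip m k

δ-skip-+ : ∀ m k j → δ (skip (suc m) k ℕ.+ suc j) (suc m) ≡ δ (k ℕ.+ j) m
δ-skip-+ m       zero    j = refl
δ-skip-+ zero    (suc k) j = refl
δ-skip-+ (suc m) (suc k) j = δ-skip-+ m k j

skip-≥ : ∀ m a → skip m (m ℕ.+ a) ≡ suc (m ℕ.+ a)
skip-≥ zero    a = refl
skip-≥ (suc m) a = cong suc (skip-≥ m a)

-- The sign of the reversal of m + 1 indices. The recursive form fits both uses,
-- `det-antidiagonalBlock` and `triangle-reflect`, each of which produces one factor `sgn (suc m)`
-- per step.
antidiagonalSign : ℕ → ℚ
antidiagonalSign zero    = 1ℚ
antidiagonalSign (suc m) = sgn (suc m) * antidiagonalSign m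

-- Column 0 has a single one, so it can be removed together with the row of that one; by `δ-skip-+`
-- the rest has the same shape for a smaller m. The deleted rows are the top m + 1, so their entries
-- to the right of the block are arbitrary.
det-antidiagonalBlock : ∀ m n (X : ℕ → ℕ → ℚ) → (∀ k j → j ≤ m → X k j ≡ δ (k ℕ.+ j) m) →
  det (suc m ℕ.+ n) (λ i j → X (toℕ i) (toℕ j))
    ≡ antidiagonalSign m * det n (λ a b → X (suc m ℕ.+ toℕ a) (suc m ℕ.+ toℕ b))
det-antidiagonalBlock zero n X eq = begin
  det (suc n) (λ i j → X (toℕ i) (toℕ j))
    ≡⟨ det-singleColumn n (λ i j → X (toℕ i) (toℕ j)) zero (λ i → eq (suc (toℕ i)) 0 z≤n) ⟩
  1ℚ * X 0 0 * det n (λ a b → X (suc (toℕ a)) (suc (toℕ b)))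
    ≡⟨ cong (λ x → 1ℚ * x * det n (λ a b → X (suc (toℕ a)) (suc (toℕ b)))) (eq 0 0 z≤n) ⟩
  1ℚ * det n (λ a b → X (suc (toℕ a)) (suc (toℕ b))) ∎
det-antidiagonalBlock (suc m) n X eq = begin
  det (suc (suc m ℕ.+ n)) (λ i j → X (toℕ i) (toℕ j))
    ≡⟨ det-singleColumn (suc m ℕ.+ n) (λ i j → X (toℕ i) (toℕ j)) r zero-elsewhere ⟩
  sgn (toℕ r) * X (toℕ r) 0 * det (suc m ℕ.+ n) (λ i j → X (toℕ (punchIn r i)) (suc (toℕ j)))
    ≡⟨ cong₂ _*_ (trans (cong (λ k → sgn k * X k 0) r≡m) (trans (cong (sgn (suc m) *_) X-m-0) (*-identityʳ (sgn (suc m)))))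
         (det-cong (suc m ℕ.+ n) (λ i j → cong (λ k → X k (suc (toℕ j))) (trans (toℕ-punchIn r i) (cong (λ k → skip k (toℕ i)) r≡m)))) ⟩
  sgn (suc m) * det (suc m ℕ.+ n) (λ i j → Y (toℕ i) (toℕ j))
    ≡⟨ cong (sgn (suc m) *_) (det-antidiagonalBlock m n Y Y-eq) ⟩
  sgn (suc m) * (antidiagonalSign m * det n (λ a b → Y (suc m ℕ.+ toℕ a) (suc m ℕ.+ toℕ b)))
    ≡⟨ sym (*-assoc (sgn (suc m)) (antidiagonalSign m) _) ⟩
  antidiagonalSign (suc m) * det n (λ a b → Y (suc m ℕ.+ toℕ a) (suc m ℕ.+ toℕ b))
    ≡⟨ cong (antidiagonalSign (suc m) *_) (det-cong n (λ a b → cong (λ k → X k (suc (suc m ℕ.+ toℕ b))) (skip-≥ (suc m) (toℕ a)))) ⟩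
  antidiagonalSign (suc m) * det n (λ a b → X (suc (suc m) ℕ.+ toℕ a) (suc (suc m) ℕ.+ toℕ b)) ∎
  where
  m<size : suc m < suc (suc m ℕ.+ n)
  m<size = s≤s (ℕₚ.m≤m+n (suc m) n)
  r : Fin (suc (suc m ℕ.+ n))
  r = Fin.fromℕ< m<size
  r≡m : toℕ r ≡ suc m
  r≡m = Finₚ.toℕ-fromℕ< m<size
  Y : ℕ → ℕ → ℚ
  Y k j = X (skip (suc m) k) (suc j)
  Y-eq : ∀ k j → j ≤ m → Y k j ≡ δ (k ℕ.+ j) m
  Y-eq k j j≤m = trans (eq (skip (suc m) k) (suc j) (s≤s j≤m)) (δ-skip-+ m k j)
  X-col-0 : ∀ k → X k 0 ≡ δ k (suc m)
  X-col-0 k = trans (eq k 0 z≤n) (cong (λ x → δ x (suc m)) (ℕₚ.+-identityʳ k))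
  X-m-0 : X (suc m) 0 ≡ 1ℚ
  X-m-0 = trans (X-col-0 (suc m)) (δ-refl m)
  zero-elsewhere : ∀ i → X (toℕ (punchIn r i)) 0 ≡ 0ℚ
  zero-elsewhere i = begin
    X (toℕ (punchIn r i)) 0               ≡⟨ X-col-0 (toℕ (punchIn r i)) ⟩
    δ (toℕ (punchIn r i)) (suc m)         ≡⟨ cong (λ k → δ k (suc m)) (trans (toℕ-punchIn r i) (cong (λ k → skip k (toℕ i)) r≡m)) ⟩
    δ (skip (suc m) (toℕ i)) (suc m)      ≡⟨ δ-skip (suc m) (toℕ i) ⟩
    0ℚ                                    ∎

-- LU factorisation of the Catalan Hankel matrices

recip₂ : ℕ → ℚ
recip₂ n = recip n * recip (suc n)

fromℕ-*-recip₂ : ∀ n → fromℕ (suc n ℕ.* suc (suc n)) * recip₂ n ≡ 1ℚ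
fromℕ-*-recip₂ n = begin
  fromℕ (suc n ℕ.* suc (suc n)) * recip₂ n
    ≡⟨ cong (_* recip₂ n) (fromℕ-* (suc n) (suc (suc n))) ⟩
  fromℕ (suc n) * fromℕ (suc (suc n)) * recip₂ n
    ≡⟨ regroup (fromℕ (suc n)) (fromℕ (suc (suc n))) (recip n) (recip (suc n)) ⟩
  fromℕ (suc n) * recip n * (fromℕ (suc (suc n)) * recip (suc n))
    ≡⟨ cong₂ _*_ (fromℕ-*-recip n) (fromℕ-*-recip (suc n)) ⟩
  1ℚ ∎
  where
  regroup : ∀ a b x y → a * b * (x * y) ≡ a * x * (b * y)
  regroup = Solver.solve-∀ ℚ-ring

-- Reduces `rhombus-+` to a polynomial identity between numerators over ℕ.
common-denominator : ∀ n a b → fromℕ a * recip₂ n + fromℕ b * recip₂ (suc n)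
  ≡ fromℕ (a ℕ.* (3 ℕ.+ n) ℕ.+ b ℕ.* suc n) * (recip n * recip (suc n) * recip (2 ℕ.+ n))
common-denominator n a b = sym (begin
  fromℕ (a ℕ.* (3 ℕ.+ n) ℕ.+ b ℕ.* suc n) * (r₀ * r₁ * r₂)
    ≡⟨ cong (_* (r₀ * r₁ * r₂)) (trans (fromℕ-+ (a ℕ.* (3 ℕ.+ n)) (b ℕ.* suc n)) (cong₂ _+_ (fromℕ-* a (3 ℕ.+ n)) (fromℕ-* b (suc n)))) ⟩
  (fromℕ a * fromℕ (3 ℕ.+ n) + fromℕ b * fromℕ (suc n)) * (r₀ * r₁ * r₂)
    ≡⟨ regroup (fromℕ a) (fromℕ (3 ℕ.+ n)) (fromℕ b) (fromℕ (suc n)) r₀ r₁ r₂ ⟩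
  fromℕ a * (r₀ * r₁) * (fromℕ (3 ℕ.+ n) * r₂) + fromℕ b * (r₁ * r₂) * (fromℕ (suc n) * r₀)
    ≡⟨ cong₂ (λ x y → fromℕ a * (r₀ * r₁) * x + fromℕ b * (r₁ * r₂) * y) (fromℕ-*-recip (2 ℕ.+ n)) (fromℕ-*-recip n) ⟩
  fromℕ a * (r₀ * r₁) * 1ℚ + fromℕ b * (r₁ * r₂) * 1ℚ
    ≡⟨ cong₂ _+_ (*-identityʳ (fromℕ a * (r₀ * r₁))) (*-identityʳ (fromℕ b * (r₁ * r₂))) ⟩
  fromℕ a * (r₀ * r₁) + fromℕ b * (r₁ * r₂) ∎)
  where
  r₀ r₁ r₂ : ℚ
  r₀ = recip n
  r₁ = recip (suc n)
  r₂ = recip (2 ℕ.+ n)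
  regroup : ∀ a x b y s t u → (a * x + b * y) * (s * t * u) ≡ a * (s * t) * (x * u) + b * (t * u) * (y * s)
  regroup = Solver.solve-∀ ℚ-ring

-- The quotient-difference table of the Catalan numbers, read off from Gauss's continued fraction
-- for the hypergeometric series of the moments Cat (m + n) / Cat m.
q e : ℕ → ℕ → ℚ
q m k       = fromℕ (2 ℕ.* (2 ℕ.* m ℕ.+ 2 ℕ.* k ℕ.+ 1) ℕ.* (m ℕ.+ k ℕ.+ 1)) * recip₂ (m ℕ.+ 2 ℕ.* k)
e m zero    = 0ℚ
e m (suc k) = fromℕ (2 ℕ.* (k ℕ.+ 1) ℕ.* (2 ℕ.* k ℕ.+ 3)) * recip₂ (suc (m ℕ.+ 2 ℕ.* k))

-- One formula for both clauses of `e`, as the factor 2k vanishes at k = 0, with a denominator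
-- adjacent to that of `q (suc m) k`.
e-suc : ∀ m k → e (suc m) k ≡ fromℕ (2 ℕ.* k ℕ.* (2 ℕ.* k ℕ.+ 1)) * recip₂ (m ℕ.+ 2 ℕ.* k)
e-suc m zero    = sym (*-zeroˡ (recip₂ (m ℕ.+ 2 ℕ.* 0)))
e-suc m (suc k) = cong₂ (λ a b → fromℕ a * recip₂ b) (numerator k) (index m k)
  where
  numerator : ∀ k → 2 ℕ.* (k ℕ.+ 1) ℕ.* (2 ℕ.* k ℕ.+ 3) ≡ 2 ℕ.* suc k ℕ.* (2 ℕ.* suc k ℕ.+ 1)
  numerator = ℕ-Solver.solve-∀
  index : ∀ m k → suc (suc m ℕ.+ 2 ℕ.* k) ≡ m ℕ.+ 2 ℕ.* suc k
  index = ℕ-Solver.solve-∀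

-- With `rhombus-*`, Rutishauser's rules for the quotient-difference table; they are the
-- compatibility of the two recurrences of `L`.
rhombus-+ : ∀ m k → e (suc m) k + q (suc m) k ≡ q m k + e m (suc k)
rhombus-+ m k = begin
  e (suc m) k + q (suc m) k
    ≡⟨ cong (_+ q (suc m) k) (e-suc m k) ⟩
  fromℕ (2 ℕ.* k ℕ.* (2 ℕ.* k ℕ.+ 1)) * recip₂ N + q (suc m) k
    ≡⟨ common-denominator N (2 ℕ.* k ℕ.* (2 ℕ.* k ℕ.+ 1)) (2 ℕ.* (2 ℕ.* suc m ℕ.+ 2 ℕ.* k ℕ.+ 1) ℕ.* (suc m ℕ.+ k ℕ.+ 1)) ⟩
  fromℕ (2 ℕ.* k ℕ.* (2 ℕ.* k ℕ.+ 1) ℕ.* (3 ℕ.+ N) ℕ.+ 2 ℕ.* (2 ℕ.* suc m ℕ.+ 2 ℕ.* k ℕ.+ 1) ℕ.* (suc m ℕ.+ k ℕ.+ 1) ℕ.* suc N)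
    * (recip N * recip (suc N) * recip (2 ℕ.+ N))
    ≡⟨ cong (λ a → fromℕ a * (recip N * recip (suc N) * recip (2 ℕ.+ N))) (numerator m k) ⟩
  fromℕ (2 ℕ.* (2 ℕ.* m ℕ.+ 2 ℕ.* k ℕ.+ 1) ℕ.* (m ℕ.+ k ℕ.+ 1) ℕ.* (3 ℕ.+ N) ℕ.+ 2 ℕ.* (k ℕ.+ 1) ℕ.* (2 ℕ.* k ℕ.+ 3) ℕ.* suc N)
    * (recip N * recip (suc N) * recip (2 ℕ.+ N))
    ≡⟨ sym (common-denominator N (2 ℕ.* (2 ℕ.* m ℕ.+ 2 ℕ.* k ℕ.+ 1) ℕ.* (m ℕ.+ k ℕ.+ 1)) (2 ℕ.* (k ℕ.+ 1) ℕ.* (2 ℕ.* k ℕ.+ 3))) ⟩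
  q m k + e m (suc k) ∎
  where
  N : ℕ
  N = m ℕ.+ 2 ℕ.* k
  numerator : ∀ m k →
    2 ℕ.* k ℕ.* (2 ℕ.* k ℕ.+ 1) ℕ.* (3 ℕ.+ (m ℕ.+ 2 ℕ.* k))
      ℕ.+ 2 ℕ.* (2 ℕ.* suc m ℕ.+ 2 ℕ.* k ℕ.+ 1) ℕ.* (suc m ℕ.+ k ℕ.+ 1) ℕ.* suc (m ℕ.+ 2 ℕ.* k)
    ≡ 2 ℕ.* (2 ℕ.* m ℕ.+ 2 ℕ.* k ℕ.+ 1) ℕ.* (m ℕ.+ k ℕ.+ 1) ℕ.* (3 ℕ.+ (m ℕ.+ 2 ℕ.* k))
      ℕ.+ 2 ℕ.* (k ℕ.+ 1) ℕ.* (2 ℕ.* k ℕ.+ 3) ℕ.* suc (m ℕ.+ 2 ℕ.* k)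
  numerator = ℕ-Solver.solve-∀

rhombus-* : ∀ m k → q (suc m) k * e (suc m) (suc k) ≡ e m (suc k) * q m (suc k)
rhombus-* m k = begin
  fromℕ a * recip₂ (suc N) * (fromℕ b * recip₂ (suc (suc N)))
    ≡⟨ permute (fromℕ a) (recip₂ (suc N)) (fromℕ b) (recip₂ (suc (suc N))) ⟩
  fromℕ b * recip₂ (suc N) * (fromℕ a * recip₂ (suc (suc N)))
    ≡⟨ cong₂ (λ x y → fromℕ b * recip₂ (suc N) * (fromℕ x * recip₂ y)) (numerator m k) (index m k) ⟩
  e m (suc k) * q m (suc k) ∎
  where
  N a b : ℕ
  N = m ℕ.+ 2 ℕ.* k
  a = 2 ℕ.* (2 ℕ.* suc m ℕ.+ 2 ℕ.* k ℕ.+ 1) ℕ.* (suc m ℕ.+ k ℕ.+ 1)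
  b = 2 ℕ.* (k ℕ.+ 1) ℕ.* (2 ℕ.* k ℕ.+ 3)
  permute : ∀ a x b y → a * x * (b * y) ≡ b * x * (a * y)
  permute = Solver.solve-∀ ℚ-ring
  numerator : ∀ m k → 2 ℕ.* (2 ℕ.* suc m ℕ.+ 2 ℕ.* k ℕ.+ 1) ℕ.* (suc m ℕ.+ k ℕ.+ 1)
    ≡ 2 ℕ.* (2 ℕ.* m ℕ.+ 2 ℕ.* suc k ℕ.+ 1) ℕ.* (m ℕ.+ suc k ℕ.+ 1)
  numerator = ℕ-Solver.solve-∀
  index : ∀ m k → suc (suc (m ℕ.+ 2 ℕ.* k)) ≡ m ℕ.+ 2 ℕ.* suc k
  index = ℕ-Solver.solve-∀

-- For m = 0 all coefficients are 1: this is the continued fraction 1/(1 - x/(1 - x/...)) of c(x).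
q-0 : ∀ k → q 0 k ≡ 1ℚ
q-0 k = trans (cong (λ a → fromℕ a * recip₂ (2 ℕ.* k)) (numerator k)) (fromℕ-*-recip₂ (2 ℕ.* k))
  where
  numerator : ∀ k → 2 ℕ.* (2 ℕ.* 0 ℕ.+ 2 ℕ.* k ℕ.+ 1) ℕ.* (0 ℕ.+ k ℕ.+ 1) ≡ suc (2 ℕ.* k) ℕ.* suc (suc (2 ℕ.* k))
  numerator = ℕ-Solver.solve-∀

e-0 : ∀ k → e 0 (suc k) ≡ 1ℚ
e-0 k = trans (cong (λ a → fromℕ a * recip₂ (suc (2 ℕ.* k))) (numerator k)) (fromℕ-*-recip₂ (suc (2 ℕ.* k)))
  where
  numerator : ∀ k → 2 ℕ.* (k ℕ.+ 1) ℕ.* (2 ℕ.* k ℕ.+ 3) ≡ suc (suc (2 ℕ.* k)) ℕ.* suc (suc (suc (2 ℕ.* k)))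
  numerator = ℕ-Solver.solve-∀

q-Cat : ∀ m → q m 0 * Cat m ≡ Cat (suc m)
q-Cat m = *-cancelˡ-suc (suc m) (begin
  fromℕ (2 ℕ.+ m) * (q m 0 * Cat m)
    ≡⟨ cong₂ (λ x y → fromℕ (2 ℕ.+ m) * (x * recip₂ y * Cat m))
         (trans (cong fromℕ (numerator m)) (fromℕ-* c (suc m))) (ℕₚ.+-identityʳ m) ⟩
  fromℕ (2 ℕ.+ m) * (fromℕ c * fromℕ (suc m) * (recip m * recip (suc m)) * Cat m)
    ≡⟨ regroup (fromℕ (2 ℕ.+ m)) (fromℕ c) (fromℕ (suc m)) (recip m) (recip (suc m)) (Cat m) ⟩
  fromℕ (suc m) * recip m * (fromℕ (2 ℕ.+ m) * recip (suc m)) * (fromℕ c * Cat m)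
    ≡⟨ cong₂ (λ x y → x * y * (fromℕ c * Cat m)) (fromℕ-*-recip m) (fromℕ-*-recip (suc m)) ⟩
  1ℚ * 1ℚ * (fromℕ c * Cat m)
    ≡⟨ *-identityˡ (fromℕ c * Cat m) ⟩
  fromℕ c * Cat m
    ≡⟨ sym (Cat-suc m) ⟩
  fromℕ (2 ℕ.+ m) * Cat (suc m) ∎)
  where
  c : ℕ
  c = 2 ℕ.* (2 ℕ.* m ℕ.+ 1)
  numerator : ∀ m → 2 ℕ.* (2 ℕ.* m ℕ.+ 2 ℕ.* 0 ℕ.+ 1) ℕ.* (m ℕ.+ 0 ℕ.+ 1) ≡ 2 ℕ.* (2 ℕ.* m ℕ.+ 1) ℕ.* suc m
  numerator = ℕ-Solver.solve-∀
  regroup : ∀ t c s x y z → t * (c * s * (x * y) * z) ≡ s * x * (t * y) * (c * z)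
  regroup = Solver.solve-∀ ℚ-ring

-- The pivots D_m(k+1)/D_m(k). The definition steps in m through `q`; `h-suc` is the step in k
-- through `e`.
h : ℕ → ℕ → ℚ
h zero    k = 1ℚ
h (suc m) k = q m k * h m k

h-suc : ∀ m k → h m (suc k) ≡ e m (suc k) * h (suc m) k
h-suc zero    k = sym (cong₂ (λ x y → x * (y * 1ℚ)) (e-0 k) (q-0 k))
h-suc (suc m) k = begin
  q m (suc k) * h m (suc k)                          ≡⟨ cong (q m (suc k) *_) (h-suc m k) ⟩
  q m (suc k) * (e m (suc k) * h (suc m) k)          ≡⟨ regroup (q m (suc k)) (e m (suc k)) (h (suc m) k) ⟩
  e m (suc k) * q m (suc k) * h (suc m) k            ≡⟨ cong (_* h (suc m) k) (sym (rhombus-* m k)) ⟩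
  q (suc m) k * e (suc m) (suc k) * h (suc m) k      ≡⟨ regroup′ (q (suc m) k) (e (suc m) (suc k)) (h (suc m) k) ⟩
  e (suc m) (suc k) * (q (suc m) k * h (suc m) k)    ∎
  where
  regroup : ∀ x y z → x * (y * z) ≡ y * x * z
  regroup = Solver.solve-∀ ℚ-ring
  regroup′ : ∀ x y z → x * y * z ≡ y * (x * z)
  regroup′ = Solver.solve-∀ ℚ-ring

h-Cat : ∀ m → h m 0 ≡ Cat m
h-Cat zero    = refl
h-Cat (suc m) = trans (cong (q m 0 *_) (h-Cat m)) (q-Cat m)

-- Row i + 1 of the Hankel matrix for m is row i of the one for m + 1, hence a recursion that lowers
-- i and raises m.
L : ℕ → ℕ → ℕ → ℚ
L m zero    k       = δ 0 k
L m (suc i) zero    = q m 0 * L (suc m) i 0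
L m (suc i) (suc k) = L (suc m) i k + q m (suc k) * L (suc m) i (suc k)

-- Induction on i for all m at once; comparing coefficients of the entries of row i of `L (suc m)`
-- leaves exactly the two rhombus rules.
L-suc : ∀ m i k → L (suc m) i k ≡ L m i k + e m (suc k) * L m i (suc k)
L-suc m zero k = begin
  δ 0 k                       ≡⟨ sym (+-identityʳ (δ 0 k)) ⟩
  δ 0 k + 0ℚ                  ≡⟨ cong (δ 0 k +_) (sym (*-zeroʳ (e m (suc k)))) ⟩
  δ 0 k + e m (suc k) * 0ℚ    ∎
L-suc m (suc i) zero = begin
  q (suc m) 0 * L (suc (suc m)) i 0
    ≡⟨ cong (q (suc m) 0 *_) (L-suc (suc m) i 0) ⟩
  q (suc m) 0 * (X 0 + e (suc m) 1 * X 1)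
    ≡⟨ expand (q (suc m) 0) (X 0) (e (suc m) 1) (X 1) ⟩
  -- The summand 0ℚ stands for `e (suc m) 0`, so that `rhombus-+ m 0` applies.
  (0ℚ + q (suc m) 0) * X 0 + q (suc m) 0 * e (suc m) 1 * X 1
    ≡⟨ cong₂ (λ x y → x * X 0 + y * X 1) (rhombus-+ m 0) (rhombus-* m 0) ⟩
  (q m 0 + e m 1) * X 0 + e m 1 * q m 1 * X 1
    ≡⟨ collect (q m 0) (e m 1) (X 0) (q m 1) (X 1) ⟩
  q m 0 * X 0 + e m 1 * (X 0 + q m 1 * X 1) ∎
  where
  X : ℕ → ℚ
  X = L (suc m) i
  expand : ∀ a x b y → a * (x + b * y) ≡ (0ℚ + a) * x + a * b * y
  expand = Solver.solve-∀ ℚ-ring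
  collect : ∀ a b x c y → (a + b) * x + b * c * y ≡ a * x + b * (x + c * y)
  collect = Solver.solve-∀ ℚ-ring
L-suc m (suc i) (suc k) = begin
  L (suc (suc m)) i k + q (suc m) (suc k) * L (suc (suc m)) i (suc k)
    ≡⟨ cong₂ (λ x y → x + q (suc m) (suc k) * y) (L-suc (suc m) i k) (L-suc (suc m) i (suc k)) ⟩
  (X k + e (suc m) (suc k) * X (suc k)) + q (suc m) (suc k) * (X (suc k) + e (suc m) (suc (suc k)) * X (suc (suc k)))
    ≡⟨ expand (X k) (e (suc m) (suc k)) (X (suc k)) (q (suc m) (suc k)) (e (suc m) (suc (suc k))) (X (suc (suc k))) ⟩
  X k + (e (suc m) (suc k) + q (suc m) (suc k)) * X (suc k) + q (suc m) (suc k) * e (suc m) (suc (suc k)) * X (suc (suc k))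
    ≡⟨ cong₂ (λ x y → X k + x * X (suc k) + y * X (suc (suc k))) (rhombus-+ m (suc k)) (rhombus-* m (suc k)) ⟩
  X k + (q m (suc k) + e m (suc (suc k))) * X (suc k) + e m (suc (suc k)) * q m (suc (suc k)) * X (suc (suc k))
    ≡⟨ collect (X k) (q m (suc k)) (e m (suc (suc k))) (X (suc k)) (q m (suc (suc k))) (X (suc (suc k))) ⟩
  (X k + q m (suc k) * X (suc k)) + e m (suc (suc k)) * (X (suc k) + q m (suc (suc k)) * X (suc (suc k))) ∎
  where
  X : ℕ → ℚ
  X = L (suc m) i
  expand : ∀ x a y b c z → (x + a * y) + b * (y + c * z) ≡ x + (a + b) * y + b * c * z
  expand = Solver.solve-∀ ℚ-ring
  collect : ∀ x a b y c z → x + (a + b) * y + b * c * z ≡ (x + a * y) + b * (y + c * z)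
  collect = Solver.solve-∀ ℚ-ring

L-above : ∀ m i k → i < k → L m i k ≡ 0ℚ
L-above m zero    (suc k) _         = refl
L-above m (suc i) (suc k) (s≤s i<k) = begin
  L (suc m) i k + q m (suc k) * L (suc m) i (suc k)
    ≡⟨ cong₂ (λ x y → x + q m (suc k) * y) (L-above (suc m) i k i<k) (L-above (suc m) i (suc k) (ℕₚ.m≤n⇒m≤1+n i<k)) ⟩
  0ℚ + q m (suc k) * 0ℚ
    ≡⟨ cong (0ℚ +_) (*-zeroʳ (q m (suc k))) ⟩
  0ℚ ∎

L-diagonal : ∀ m k → L m k k ≡ 1ℚ
L-diagonal m zero    = refl
L-diagonal m (suc k) = trans
  (cong₂ (λ x y → x + q m (suc k) * y) (L-diagonal (suc m) k) (L-above (suc m) k (suc k) ℕₚ.≤-refl))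
  (cong (1ℚ +_) (*-zeroʳ (q m (suc k))))

L-lowerUnitriangular : ∀ m → LowerUnitriangular (L m)
L-lowerUnitriangular m = lowerUnitriangular (L-diagonal m) (L-above m)

Cat-L : ∀ m j → Cat m * L m j 0 ≡ Cat (m ℕ.+ j)
Cat-L m zero    = trans (*-identityʳ (Cat m)) (cong Cat (sym (ℕₚ.+-identityʳ m)))
Cat-L m (suc j) = begin
  Cat m * (q m 0 * L (suc m) j 0)    ≡⟨ regroup (Cat m) (q m 0) (L (suc m) j 0) ⟩
  q m 0 * Cat m * L (suc m) j 0      ≡⟨ cong (_* L (suc m) j 0) (q-Cat m) ⟩
  Cat (suc m) * L (suc m) j 0        ≡⟨ Cat-L (suc m) j ⟩
  Cat (suc m ℕ.+ j)                  ≡⟨ cong Cat (sym (ℕₚ.+-suc m j)) ⟩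
  Cat (m ℕ.+ suc j)                  ∎
  where
  regroup : ∀ x y z → x * (y * z) ≡ y * x * z
  regroup = Solver.solve-∀ ℚ-ring

sum-last : ∀ n (f : ℕ → ℚ) → sum {suc n} (f ∘ toℕ) ≡ sum {n} (f ∘ toℕ) + f n
sum-last zero    f = +-comm (f 0) 0ℚ
sum-last (suc n) f = trans (cong (f 0 +_) (sum-last n (f ∘ suc)))
  (sym (+-assoc (f 0) (sum {n} (f ∘ suc ∘ toℕ)) (f (suc n))))

-- The upper factor diag(h m) · (L m)ᵀ.
T : ℕ → ℕ → ℕ → ℚ
T m k j = h m k * L m j k

T-below : ∀ m k j → j < k → T m k j ≡ 0ℚ
T-below m k j j<k = trans (cong (h m k *_) (L-above m j k j<k)) (*-zeroʳ (h m k))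

T-suc : ∀ m k j → T (suc m) k j ≡ q m k * T m k j + T m (suc k) j
T-suc m k j = begin
  q m k * h m k * L (suc m) j k
    ≡⟨ cong (q m k * h m k *_) (L-suc m j k) ⟩
  q m k * h m k * (L m j k + e m (suc k) * L m j (suc k))
    ≡⟨ expand (q m k) (h m k) (L m j k) (e m (suc k)) (L m j (suc k)) ⟩
  q m k * (h m k * L m j k) + e m (suc k) * (q m k * h m k) * L m j (suc k)
    ≡⟨ cong (λ x → q m k * (h m k * L m j k) + x * L m j (suc k)) (sym (h-suc m k)) ⟩
  q m k * T m k j + T m (suc k) j ∎
  where
  expand : ∀ a b x c y → a * b * (x + c * y) ≡ a * (b * x) + c * (a * b) * y
  expand = Solver.solve-∀ ℚ-ring

-- Summation by parts: the bidiagonal matrix that links the rows of `L m` to those of `L (suc m)`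
-- moves over to the right factor, where `T-suc` absorbs it.
L*T-suc : ∀ n m i j → j < suc n →
  sum {suc n} (λ k → L m (suc i) (toℕ k) * T m (toℕ k) j)
    ≡ sum {suc n} (λ k → L (suc m) i (toℕ k) * T (suc m) (toℕ k) j)
L*T-suc n m i j j<n = begin
  q m 0 * Y 0 * t 0 + sum {n} (λ k → (Y (toℕ k) + q m (suc (toℕ k)) * Y (suc (toℕ k))) * t (suc (toℕ k)))
    ≡⟨ cong (q m 0 * Y 0 * t 0 +_) (trans
         (sum-cong-≗ {n} (λ k → *-distribʳ-+ (t (suc (toℕ k))) (Y (toℕ k)) (q m (suc (toℕ k)) * Y (suc (toℕ k)))))
         (∑-distrib-+ {n} (shifted ∘ toℕ) (scaled ∘ suc ∘ toℕ))) ⟩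
  scaled 0 + (sum {n} (shifted ∘ toℕ) + sum {n} (scaled ∘ suc ∘ toℕ))
    ≡⟨ regroup (scaled 0) (sum {n} (shifted ∘ toℕ)) (sum {n} (scaled ∘ suc ∘ toℕ)) ⟩
  sum {suc n} (scaled ∘ toℕ) + (sum {n} (shifted ∘ toℕ) + 0ℚ)
    -- The sum of shifted terms is one term short. The missing one contains `T m (suc n) j`, which
    -- vanishes because j < n + 1.
    ≡⟨ cong (λ x → sum {suc n} (scaled ∘ toℕ) + (sum {n} (shifted ∘ toℕ) + x)) (sym last-zero) ⟩
  sum {suc n} (scaled ∘ toℕ) + (sum {n} (shifted ∘ toℕ) + shifted n)
    ≡⟨ cong (sum {suc n} (scaled ∘ toℕ) +_) (sym (sum-last n shifted)) ⟩
  sum {suc n} (scaled ∘ toℕ) + sum {suc n} (shifted ∘ toℕ)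
    ≡⟨ sym (∑-distrib-+ {suc n} (scaled ∘ toℕ) (shifted ∘ toℕ)) ⟩
  sum {suc n} (λ k → scaled (toℕ k) + shifted (toℕ k))
    ≡⟨ sum-cong-≗ {suc n} (λ k → trans (collect (q m (toℕ k)) (Y (toℕ k)) (t (toℕ k)) (t (suc (toℕ k))))
         (cong (Y (toℕ k) *_) (sym (T-suc m (toℕ k) j)))) ⟩
  sum {suc n} (λ k → L (suc m) i (toℕ k) * T (suc m) (toℕ k) j) ∎
  where
  Y t scaled shifted : ℕ → ℚ
  Y = L (suc m) i
  t k = T m k j
  scaled k = q m k * Y k * t k
  shifted k = Y k * t (suc k)
  last-zero : shifted n ≡ 0ℚ
  last-zero = trans (cong (Y n *_) (T-below m (suc n) j j<n)) (*-zeroʳ (Y n))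
  regroup : ∀ x y z → x + (y + z) ≡ (x + z) + (y + 0ℚ)
  regroup = Solver.solve-∀ ℚ-ring
  collect : ∀ a y t u → a * y * t + y * u ≡ y * (a * t + u)
  collect = Solver.solve-∀ ℚ-ring

L*T-Cat : ∀ n m i j → j < n →
  sum {n} (λ k → L m i (toℕ k) * T m (toℕ k) j) ≡ Cat (m ℕ.+ (i ℕ.+ j))
L*T-Cat (suc n) m zero j j<n = begin
  1ℚ * T m 0 j + sum {n} (λ k → 0ℚ * T m (suc (toℕ k)) j)
    ≡⟨ cong₂ _+_ (*-identityˡ (T m 0 j)) (sum-zero {n} (λ k → 0ℚ * T m (suc (toℕ k)) j) (λ k → *-zeroˡ (T m (suc (toℕ k)) j))) ⟩
  h m 0 * L m j 0 + 0ℚ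
    ≡⟨ +-identityʳ (h m 0 * L m j 0) ⟩
  h m 0 * L m j 0
    ≡⟨ cong (_* L m j 0) (h-Cat m) ⟩
  Cat m * L m j 0
    ≡⟨ Cat-L m j ⟩
  Cat (m ℕ.+ j) ∎
L*T-Cat (suc n) m (suc i) j j<n = trans (L*T-suc n m i j j<n)
  (trans (L*T-Cat (suc n) (suc m) i j j<n) (cong Cat (sym (ℕₚ.+-suc m (i ℕ.+ j)))))

det-L-* : ∀ n m (V : ℕ → ℕ → ℚ) → (∀ k j → j < k → V k j ≡ 0ℚ) →
  det n (λ i j → sum {n} (λ k → L m (toℕ i) (toℕ k) * V (toℕ k) (toℕ j))) ≡ product {n} (λ k → V (toℕ k) (toℕ k))
det-L-* n m V below = trans
  (det-lowerUnitriangular-* n (L m) (L-lowerUnitriangular m) (λ k j → V (toℕ k) (toℕ j)))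
  (det-upperTriangular n V below)

product-cong : ∀ n {f g : Fin n → ℚ} → (∀ k → f k ≡ g k) → product f ≡ product g
product-cong zero    eq = refl
product-cong (suc n) eq = cong₂ _*_ (eq zero) (product-cong n (eq ∘ suc))

D-product : ∀ m n → D (ℤ.+ m) n ≡ product {n} (λ k → h m (toℕ k))
D-product m n = begin
  det n (λ i j → Cat (m ℕ.+ toℕ i ℕ.+ toℕ j))
    ≡⟨ det-cong n (λ i j → trans (cong Cat (ℕₚ.+-assoc m (toℕ i) (toℕ j)))
         (sym (L*T-Cat n m (toℕ i) (toℕ j) (Finₚ.toℕ<n j)))) ⟩
  det n (λ i j → sum {n} (λ k → L m (toℕ i) (toℕ k) * T m (toℕ k) (toℕ j)))
    ≡⟨ det-L-* n m (T m) (T-below m) ⟩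
  product {n} (λ k → h m (toℕ k) * L m (toℕ k) (toℕ k))
    ≡⟨ product-cong n (λ k → trans (cong (h m (toℕ k) *_) (L-diagonal m (toℕ k))) (*-identityʳ (h m (toℕ k)))) ⟩
  product {n} (λ k → h m (toℕ k)) ∎

-- The polynomials p

prod : ℕ → (ℕ → ℚ) → ℚ
prod n f = product {n} (f ∘ toℕ)

prod-cong : ∀ n {f g : ℕ → ℚ} → (∀ k → f k ≡ g k) → prod n f ≡ prod n g
prod-cong n eq = product-cong n (eq ∘ toℕ)

prod-* : ∀ n (f g : ℕ → ℚ) → prod n (λ k → f k * g k) ≡ prod n f * prod n g
prod-* n f g = ∏-distrib-* {n} (f ∘ toℕ) (g ∘ toℕ)

prod-last : ∀ n (f : ℕ → ℚ) → prod (suc n) f ≡ prod n f * f n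
prod-last zero    f = *-comm (f 0) 1ℚ
prod-last (suc n) f = trans (cong (f 0 *_) (prod-last n (f ∘ suc))) (sym (*-assoc (f 0) (prod n (f ∘ suc)) (f (suc n))))

prod-one : ∀ n {f : ℕ → ℚ} → (∀ k → f k ≡ 1ℚ) → prod n f ≡ 1ℚ
prod-one zero    eq = refl
prod-one (suc n) eq = cong₂ _*_ (eq 0) (prod-one n (eq ∘ suc))

prod-zero : ∀ n (f : ℕ → ℚ) k → k < n → f k ≡ 0ℚ → prod n f ≡ 0ℚ
prod-zero (suc n) f zero    _         eq = trans (cong (_* prod n (f ∘ suc)) eq) (*-zeroˡ (prod n (f ∘ suc)))
prod-zero (suc n) f (suc k) (s≤s k<n) eq = trans (cong (f 0 *_) (prod-zero n (f ∘ suc) k k<n eq)) (*-zeroʳ (f 0))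

-- A top-level copy of the local factor of `p`; the two unfold to the same expression.
p-factor : ℚ → ℕ → ℕ → ℚ
p-factor x a b = (fromℕ 2 * x + fromℕ (suc a) + fromℕ (suc b)) * recip (a ℕ.+ suc b)

-- Raising every argument by 2 telescopes to two factors at each end. The weights `c` will be the
-- denominators of `p`.
prod-shift : ∀ n z (c : ℕ → ℚ) →
  fromℕ (z ℕ.* suc z) * prod n (λ a → fromℕ (2 ℕ.+ z ℕ.+ a) * c a)
    ≡ fromℕ ((z ℕ.+ n) ℕ.* suc (z ℕ.+ n)) * prod n (λ a → fromℕ (z ℕ.+ a) * c a)
prod-shift zero    z c = cong (λ x → fromℕ (x ℕ.* suc x) * 1ℚ) (sym (ℕₚ.+-identityʳ z))
prod-shift (suc n) z c = begin
  fromℕ (z ℕ.* suc z) * prod (suc n) f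
    ≡⟨ cong (fromℕ (z ℕ.* suc z) *_) (prod-last n f) ⟩
  fromℕ (z ℕ.* suc z) * (prod n f * (fromℕ (2 ℕ.+ z ℕ.+ n) * c n))
    ≡⟨ sym (*-assoc (fromℕ (z ℕ.* suc z)) (prod n f) (fromℕ (2 ℕ.+ z ℕ.+ n) * c n)) ⟩
  fromℕ (z ℕ.* suc z) * prod n f * (fromℕ (2 ℕ.+ z ℕ.+ n) * c n)
    ≡⟨ cong (_* (fromℕ (2 ℕ.+ z ℕ.+ n) * c n)) (prod-shift n z c) ⟩
  fromℕ ((z ℕ.+ n) ℕ.* suc (z ℕ.+ n)) * prod n g * (fromℕ (2 ℕ.+ z ℕ.+ n) * c n)
    ≡⟨ regroup (fromℕ ((z ℕ.+ n) ℕ.* suc (z ℕ.+ n))) (prod n g) (fromℕ (2 ℕ.+ z ℕ.+ n)) (c n) ⟩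
  fromℕ ((z ℕ.+ n) ℕ.* suc (z ℕ.+ n)) * fromℕ (2 ℕ.+ z ℕ.+ n) * (prod n g * c n)
    ≡⟨ cong (_* (prod n g * c n)) (trans (sym (fromℕ-* ((z ℕ.+ n) ℕ.* suc (z ℕ.+ n)) (2 ℕ.+ z ℕ.+ n)))
         (trans (cong fromℕ (numerator z n)) (fromℕ-* ((z ℕ.+ suc n) ℕ.* suc (z ℕ.+ suc n)) (z ℕ.+ n)))) ⟩
  fromℕ ((z ℕ.+ suc n) ℕ.* suc (z ℕ.+ suc n)) * fromℕ (z ℕ.+ n) * (prod n g * c n)
    ≡⟨ regroup′ (fromℕ ((z ℕ.+ suc n) ℕ.* suc (z ℕ.+ suc n))) (fromℕ (z ℕ.+ n)) (prod n g) (c n) ⟩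
  fromℕ ((z ℕ.+ suc n) ℕ.* suc (z ℕ.+ suc n)) * (prod n g * (fromℕ (z ℕ.+ n) * c n))
    ≡⟨ cong (fromℕ ((z ℕ.+ suc n) ℕ.* suc (z ℕ.+ suc n)) *_) (sym (prod-last n g)) ⟩
  fromℕ ((z ℕ.+ suc n) ℕ.* suc (z ℕ.+ suc n)) * prod (suc n) g ∎
  where
  f g : ℕ → ℚ
  f a = fromℕ (2 ℕ.+ z ℕ.+ a) * c a
  g a = fromℕ (z ℕ.+ a) * c a
  regroup : ∀ x y u v → x * y * (u * v) ≡ x * u * (y * v)
  regroup = Solver.solve-∀ ℚ-ring
  regroup′ : ∀ x u y v → x * u * (y * v) ≡ x * (y * (u * v))
  regroup′ = Solver.solve-∀ ℚ-ring
  numerator : ∀ z n → (z ℕ.+ n) ℕ.* suc (z ℕ.+ n) ℕ.* (2 ℕ.+ z ℕ.+ n)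
    ≡ (z ℕ.+ suc n) ℕ.* suc (z ℕ.+ suc n) ℕ.* (z ℕ.+ n)
  numerator = ℕ-Solver.solve-∀

-- The quotient p_{m+2}(n)/p_{m+1}(n), that is, the factors with j = m + 1.
p-row : ℕ → ℕ → ℚ
p-row m n = prod (suc m) (λ a → fromℕ (2 ℕ.* n ℕ.+ (2 ℕ.+ m) ℕ.+ a) * recip (a ℕ.+ suc m))

p-row-suc : ∀ m n → p-row m (suc n) ≡ p-row m n * q (suc m) n
p-row-suc m n = begin
  p-row m (suc n)
    ≡⟨ prod-cong (suc m) (λ a → cong (λ x → fromℕ x * c a) (index m n a)) ⟩
  prod (suc m) (λ a → fromℕ (2 ℕ.+ z ℕ.+ a) * c a)
    ≡⟨ sym (*-identityˡ (prod (suc m) (λ a → fromℕ (2 ℕ.+ z ℕ.+ a) * c a))) ⟩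
  1ℚ * prod (suc m) (λ a → fromℕ (2 ℕ.+ z ℕ.+ a) * c a)
    -- Since `suc y` equals z, this writes 1 as z(z + 1) · `recip₂ y`: the first factor is the one
    -- `prod-shift` consumes, the second becomes the denominator of `q (suc m) n`.
    ≡⟨ cong (_* prod (suc m) (λ a → fromℕ (2 ℕ.+ z ℕ.+ a) * c a))
         (trans (sym (fromℕ-*-recip₂ y)) (cong (λ x → fromℕ (x ℕ.* suc x) * r) (suc-y m n))) ⟩
  fromℕ (z ℕ.* suc z) * r * prod (suc m) (λ a → fromℕ (2 ℕ.+ z ℕ.+ a) * c a)
    ≡⟨ regroup (fromℕ (z ℕ.* suc z)) r (prod (suc m) (λ a → fromℕ (2 ℕ.+ z ℕ.+ a) * c a)) ⟩
  fromℕ (z ℕ.* suc z) * prod (suc m) (λ a → fromℕ (2 ℕ.+ z ℕ.+ a) * c a) * r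
    ≡⟨ cong (_* r) (prod-shift (suc m) z c) ⟩
  fromℕ ((z ℕ.+ suc m) ℕ.* suc (z ℕ.+ suc m)) * p-row m n * r
    ≡⟨ regroup′ (fromℕ ((z ℕ.+ suc m) ℕ.* suc (z ℕ.+ suc m))) (p-row m n) r ⟩
  p-row m n * (fromℕ ((z ℕ.+ suc m) ℕ.* suc (z ℕ.+ suc m)) * r)
    ≡⟨ cong (λ x → p-row m n * (fromℕ x * r)) (numerator m n) ⟩
  p-row m n * q (suc m) n ∎
  where
  y z : ℕ
  y = suc m ℕ.+ 2 ℕ.* n
  z = 2 ℕ.* n ℕ.+ (2 ℕ.+ m)
  r : ℚ
  r = recip₂ y
  c : ℕ → ℚ
  c a = recip (a ℕ.+ suc m)
  index : ∀ m n a → 2 ℕ.* suc n ℕ.+ (2 ℕ.+ m) ℕ.+ a ≡ 2 ℕ.+ (2 ℕ.* n ℕ.+ (2 ℕ.+ m)) ℕ.+ a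
  index = ℕ-Solver.solve-∀
  suc-y : ∀ m n → suc (suc m ℕ.+ 2 ℕ.* n) ≡ 2 ℕ.* n ℕ.+ (2 ℕ.+ m)
  suc-y = ℕ-Solver.solve-∀
  numerator : ∀ m n → (2 ℕ.* n ℕ.+ (2 ℕ.+ m) ℕ.+ suc m) ℕ.* suc (2 ℕ.* n ℕ.+ (2 ℕ.+ m) ℕ.+ suc m)
    ≡ 2 ℕ.* (2 ℕ.* suc m ℕ.+ 2 ℕ.* n ℕ.+ 1) ℕ.* (suc m ℕ.+ n ℕ.+ 1)
  numerator = ℕ-Solver.solve-∀
  regroup : ∀ x y z → x * y * z ≡ x * z * y
  regroup = Solver.solve-∀ ℚ-ring
  regroup′ : ∀ x y z → x * y * z ≡ y * (x * z)
  regroup′ = Solver.solve-∀ ℚ-ring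

prod-q : ∀ m n → prod n (q (suc m)) ≡ p-row m n
prod-q m zero    = sym (prod-one (suc m) λ a → trans
  (cong (λ x → fromℕ x * recip (a ℕ.+ suc m)) (index m a)) (fromℕ-*-recip (a ℕ.+ suc m)))
  where
  index : ∀ m a → 2 ℕ.* 0 ℕ.+ (2 ℕ.+ m) ℕ.+ a ≡ suc (a ℕ.+ suc m)
  index = ℕ-Solver.solve-∀
prod-q m (suc n) = begin
  prod (suc n) (q (suc m))            ≡⟨ prod-last n (q (suc m)) ⟩
  prod n (q (suc m)) * q (suc m) n    ≡⟨ cong (_* q (suc m) n) (prod-q m n) ⟩
  p-row m n * q (suc m) n             ≡⟨ sym (p-row-suc m n) ⟩
  p-row m (suc n)                     ∎

-- Induction on m: one step multiplies the left side by a product of `q`'s and the right side by the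
-- new last row of the index triangle, which agree by `prod-q`.
prod-h : ∀ m n → prod n (h (suc m)) ≡ p (suc m) (fromℕ n)
prod-h zero    n = prod-one n (λ k → cong (_* 1ℚ) (q-0 k))
prod-h (suc m) n = begin
  prod n (λ k → q (suc m) k * h (suc m) k)      ≡⟨ prod-* n (q (suc m)) (h (suc m)) ⟩
  prod n (q (suc m)) * prod n (h (suc m))       ≡⟨ cong₂ _*_ (prod-q m n) (prod-h m n) ⟩
  p-row m n * p (suc m) (fromℕ n)               ≡⟨ *-comm (p-row m n) (p (suc m) (fromℕ n)) ⟩
  p (suc m) (fromℕ n) * p-row m n               ≡⟨ cong (p (suc m) (fromℕ n) *_) (prod-cong (suc m) (λ a → cong (_* recip (a ℕ.+ suc m)) (numerator a))) ⟩
  p (suc m) (fromℕ n) * prod (suc m) (λ a → p-factor (fromℕ n) a m)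
    ≡⟨ sym (prod-last m (λ b → prod (suc b) (λ a → p-factor (fromℕ n) a b))) ⟩
  p (suc (suc m)) (fromℕ n)                     ∎
  where
  index : ∀ m n a → 2 ℕ.* n ℕ.+ (2 ℕ.+ m) ℕ.+ a ≡ 2 ℕ.* n ℕ.+ suc a ℕ.+ suc m
  index = ℕ-Solver.solve-∀
  numerator : ∀ a → fromℕ (2 ℕ.* n ℕ.+ (2 ℕ.+ m) ℕ.+ a) ≡ fromℕ 2 * fromℕ n + fromℕ (suc a) + fromℕ (suc m)
  numerator a = begin
    fromℕ (2 ℕ.* n ℕ.+ (2 ℕ.+ m) ℕ.+ a)               ≡⟨ cong fromℕ (index m n a) ⟩
    fromℕ (2 ℕ.* n ℕ.+ suc a ℕ.+ suc m)               ≡⟨ fromℕ-+ (2 ℕ.* n ℕ.+ suc a) (suc m) ⟩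
    fromℕ (2 ℕ.* n ℕ.+ suc a) + fromℕ (suc m)         ≡⟨ cong (_+ fromℕ (suc m)) (fromℕ-+ (2 ℕ.* n) (suc a)) ⟩
    fromℕ (2 ℕ.* n) + fromℕ (suc a) + fromℕ (suc m)   ≡⟨ cong (λ x → x + fromℕ (suc a) + fromℕ (suc m)) (fromℕ-* 2 n) ⟩
    fromℕ 2 * fromℕ n + fromℕ (suc a) + fromℕ (suc m) ∎

-- The diagonal factor i = j = n + 1 has numerator 2x + 2(n + 1); it occurs because n + 1 ≤ m.
p-neg-zero : ∀ m n → n < m → p (suc m) (- fromℕ (suc n)) ≡ 0ℚ
p-neg-zero m n n<m = prod-zero m (λ b → prod (suc b) (λ a → p-factor x a b)) n n<m
  (prod-zero (suc n) (λ a → p-factor x a n) n ℕₚ.≤-refl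
    (trans (cong (_* recip (n ℕ.+ suc n)) (cancel (fromℕ (suc n)))) (*-zeroˡ (recip (n ℕ.+ suc n)))))
  where
  x : ℚ
  x = - fromℕ (suc n)
  cancel : ∀ y → (1ℚ + 1ℚ) * - y + y + y ≡ 0ℚ
  cancel = Solver.solve-∀ ℚ-ring

-- The numerator of `p (suc m)` at y = 2x + 2. The denominators do not depend on x, so the
-- reflection concerns this part only.
triangle : ℕ → ℚ → ℚ
triangle m y = prod m (λ b → prod (suc b) (λ a → y + fromℕ a + fromℕ b))

triangle-last : ∀ m y → triangle (suc m) y ≡ triangle m y * prod (suc m) (λ a → y + fromℕ a + fromℕ m)
triangle-last m y = prod-last m (λ b → prod (suc b) (λ a → y + fromℕ a + fromℕ b))

-- Removing a = 0 lowers both remaining indices by one, which is compensated by y + 2. The product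
-- is nested by b, so this takes an induction on m.
triangle-head : ∀ m y → triangle (suc m) y ≡ prod (suc m) (λ c → y + fromℕ c) * triangle m (y + (1ℚ + 1ℚ))
triangle-head zero    y = simplify y
  where
  simplify : ∀ y → (y + 0ℚ + 0ℚ) * 1ℚ * 1ℚ ≡ (y + 0ℚ) * 1ℚ * 1ℚ
  simplify = Solver.solve-∀ ℚ-ring
triangle-head (suc m) y = begin
  triangle (suc (suc m)) y
    ≡⟨ triangle-last (suc m) y ⟩
  triangle (suc m) y * ((y + 0ℚ + fromℕ (suc m)) * prod (suc m) (λ a → y + fromℕ (suc a) + fromℕ (suc m)))
    ≡⟨ cong₂ (λ u v → u * ((y + 0ℚ + fromℕ (suc m)) * v)) (triangle-head m y)
         (prod-cong (suc m) (λ a → trans (cong₂ (λ u v → y + u + v) (fromℕ-suc a) (fromℕ-suc m)) (shift y (fromℕ a) (fromℕ m)))) ⟩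
  prod (suc m) f * triangle m (y + (1ℚ + 1ℚ)) * ((y + 0ℚ + fromℕ (suc m)) * row)
    ≡⟨ regroup (prod (suc m) f) (triangle m (y + (1ℚ + 1ℚ))) y (fromℕ (suc m)) row ⟩
  prod (suc m) f * (y + fromℕ (suc m)) * (triangle m (y + (1ℚ + 1ℚ)) * row)
    ≡⟨ sym (cong₂ _*_ (prod-last (suc m) f) (triangle-last m (y + (1ℚ + 1ℚ)))) ⟩
  prod (suc (suc m)) f * triangle (suc m) (y + (1ℚ + 1ℚ)) ∎
  where
  f : ℕ → ℚ
  f c = y + fromℕ c
  row : ℚ
  row = prod (suc m) (λ a → y + (1ℚ + 1ℚ) + fromℕ a + fromℕ m)
  shift : ∀ y a m → y + (1ℚ + a) + (1ℚ + m) ≡ y + (1ℚ + 1ℚ) + a + m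
  shift = Solver.solve-∀ ℚ-ring
  regroup : ∀ p t y m r → p * t * ((y + 0ℚ + m) * r) ≡ p * (y + m) * (t * r)
  regroup = Solver.solve-∀ ℚ-ring

rising-reflect : ∀ n y → prod (suc n) (λ a → - y - fromℕ n + fromℕ a) ≡ sgn (suc n) * prod (suc n) (λ c → y + fromℕ c)
rising-reflect zero    y = simplify y
  where
  simplify : ∀ y → (- y - 0ℚ + 0ℚ) * 1ℚ ≡ - 1ℚ * 1ℚ * ((y + 0ℚ) * 1ℚ)
  simplify = Solver.solve-∀ ℚ-ring
rising-reflect (suc n) y = begin
  (- y - fromℕ (suc n) + 0ℚ) * prod (suc n) (λ a → - y - fromℕ (suc n) + fromℕ (suc a))
    ≡⟨ cong ((- y - fromℕ (suc n) + 0ℚ) *_) (trans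
         (prod-cong (suc n) (λ a → trans (cong₂ (λ u v → - y - u + v) (fromℕ-suc n) (fromℕ-suc a)) (shift y (fromℕ n) (fromℕ a))))
         (rising-reflect n y)) ⟩
  (- y - fromℕ (suc n) + 0ℚ) * (sgn (suc n) * prod (suc n) (λ c → y + fromℕ c))
    ≡⟨ regroup y (fromℕ (suc n)) (sgn (suc n)) (prod (suc n) (λ c → y + fromℕ c)) ⟩
  sgn (suc (suc n)) * (prod (suc n) (λ c → y + fromℕ c) * (y + fromℕ (suc n)))
    ≡⟨ cong (sgn (suc (suc n)) *_) (sym (prod-last (suc n) (λ c → y + fromℕ c))) ⟩
  sgn (suc (suc n)) * prod (suc (suc n)) (λ c → y + fromℕ c) ∎
  where
  shift : ∀ y n a → - y - (1ℚ + n) + (1ℚ + a) ≡ - y - n + a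
  shift = Solver.solve-∀ ℚ-ring
  regroup : ∀ y n s x → (- y - n + 0ℚ) * (s * x) ≡ - 1ℚ * s * (x * (y + n))
  regroup = Solver.solve-∀ ℚ-ring

-- Induction on m, peeling off the last row of the left triangle and the first column of the right one.
triangle-reflect : ∀ m y → triangle m ((1ℚ + 1ℚ) - y - (1ℚ + 1ℚ) * fromℕ m) ≡ antidiagonalSign m * triangle m y
triangle-reflect zero    y = refl
triangle-reflect (suc m) y = begin
  triangle (suc m) y′
    ≡⟨ triangle-last m y′ ⟩
  triangle m y′ * prod (suc m) (λ a → y′ + fromℕ a + fromℕ m)
    -- The argument 2 - y - 2(m + 1) is also 2 - (y + 2) - 2m, the reflection of y + 2 in the
    -- smaller triangle; on the last row it gives the factors -(y + m - a).
    ≡⟨ cong₂ _*_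
         (trans (cong (triangle m) (trans (cong (λ x → (1ℚ + 1ℚ) - y - (1ℚ + 1ℚ) * x) (fromℕ-suc m)) (shift y (fromℕ m))))
           (triangle-reflect m (y + (1ℚ + 1ℚ))))
         (trans (prod-cong (suc m) (λ a → trans (cong (λ x → (1ℚ + 1ℚ) - y - (1ℚ + 1ℚ) * x + fromℕ a + fromℕ m) (fromℕ-suc m))
             (shift′ y (fromℕ m) (fromℕ a))))
           (rising-reflect m y)) ⟩
  antidiagonalSign m * triangle m (y + (1ℚ + 1ℚ)) * (sgn (suc m) * prod (suc m) (λ c → y + fromℕ c))
    ≡⟨ regroup (antidiagonalSign m) (triangle m (y + (1ℚ + 1ℚ))) (sgn (suc m)) (prod (suc m) (λ c → y + fromℕ c)) ⟩
  antidiagonalSign (suc m) * (prod (suc m) (λ c → y + fromℕ c) * triangle m (y + (1ℚ + 1ℚ)))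
    ≡⟨ cong (antidiagonalSign (suc m) *_) (sym (triangle-head m y)) ⟩
  antidiagonalSign (suc m) * triangle (suc m) y ∎
  where
  y′ : ℚ
  y′ = (1ℚ + 1ℚ) - y - (1ℚ + 1ℚ) * fromℕ (suc m)
  shift : ∀ y m → (1ℚ + 1ℚ) - y - (1ℚ + 1ℚ) * (1ℚ + m) ≡ (1ℚ + 1ℚ) - (y + (1ℚ + 1ℚ)) - (1ℚ + 1ℚ) * m
  shift = Solver.solve-∀ ℚ-ring
  shift′ : ∀ y m a → (1ℚ + 1ℚ) - y - (1ℚ + 1ℚ) * (1ℚ + m) + a + m ≡ - y - m + a
  shift′ = Solver.solve-∀ ℚ-ring
  regroup : ∀ s t u v → s * t * (u * v) ≡ u * s * (v * t)
  regroup = Solver.solve-∀ ℚ-ring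

p-triangle : ∀ m x → p (suc m) x
  ≡ triangle m ((1ℚ + 1ℚ) * x + (1ℚ + 1ℚ)) * prod m (λ b → prod (suc b) (λ a → recip (a ℕ.+ suc b)))
p-triangle m x = trans
  (prod-cong m (λ b → trans
    (prod-cong (suc b) (λ a → cong (_* recip (a ℕ.+ suc b))
      (trans (cong₂ (λ u v → (1ℚ + 1ℚ) * x + u + v) (fromℕ-suc a) (fromℕ-suc b)) (regroup x (fromℕ a) (fromℕ b)))))
    (prod-* (suc b) (λ a → (1ℚ + 1ℚ) * x + (1ℚ + 1ℚ) + fromℕ a + fromℕ b) (λ a → recip (a ℕ.+ suc b)))))
  (prod-* m (λ b → prod (suc b) (λ a → (1ℚ + 1ℚ) * x + (1ℚ + 1ℚ) + fromℕ a + fromℕ b))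
    (λ b → prod (suc b) (λ a → recip (a ℕ.+ suc b))))
  where
  regroup : ∀ x a b → (1ℚ + 1ℚ) * x + (1ℚ + a) + (1ℚ + b) ≡ (1ℚ + 1ℚ) * x + (1ℚ + 1ℚ) + a + b
  regroup = Solver.solve-∀ ℚ-ring

p-reflect : ∀ m n → p (suc m) (- fromℕ (suc m ℕ.+ n)) ≡ antidiagonalSign m * p (suc m) (fromℕ n)
p-reflect m n = begin
  p (suc m) (- fromℕ (suc m ℕ.+ n))
    ≡⟨ p-triangle m (- fromℕ (suc m ℕ.+ n)) ⟩
  triangle m ((1ℚ + 1ℚ) * - fromℕ (suc m ℕ.+ n) + (1ℚ + 1ℚ)) * den
    ≡⟨ cong (λ x → triangle m x * den) (trans
         (cong (λ x → (1ℚ + 1ℚ) * - x + (1ℚ + 1ℚ)) (trans (fromℕ-+ (suc m) n) (cong (_+ fromℕ n) (fromℕ-suc m))))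
         (shift (fromℕ m) (fromℕ n))) ⟩
  triangle m ((1ℚ + 1ℚ) - y - (1ℚ + 1ℚ) * fromℕ m) * den
    ≡⟨ cong (_* den) (triangle-reflect m y) ⟩
  antidiagonalSign m * triangle m y * den
    ≡⟨ *-assoc (antidiagonalSign m) (triangle m y) den ⟩
  antidiagonalSign m * (triangle m y * den)
    ≡⟨ cong (antidiagonalSign m *_) (sym (p-triangle m (fromℕ n))) ⟩
  antidiagonalSign m * p (suc m) (fromℕ n) ∎
  where
  y den : ℚ
  y = (1ℚ + 1ℚ) * fromℕ n + (1ℚ + 1ℚ)
  den = prod m (λ b → prod (suc b) (λ a → recip (a ℕ.+ suc b)))
  shift : ∀ m n → (1ℚ + 1ℚ) * - (1ℚ + m + n) + (1ℚ + 1ℚ) ≡ (1ℚ + 1ℚ) - ((1ℚ + 1ℚ) * n + (1ℚ + 1ℚ)) - (1ℚ + 1ℚ) * m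
  shift = Solver.solve-∀ ℚ-ring

sgn-+ : ∀ a b → sgn (a ℕ.+ b) ≡ sgn a * sgn b
sgn-+ zero    b = sym (*-identityˡ (sgn b))
sgn-+ (suc a) b = trans (cong (- 1ℚ *_) (sgn-+ a b)) (sym (*-assoc (- 1ℚ) (sgn a) (sgn b)))

antidiagonalSign-C : ∀ m → antidiagonalSign m ≡ sgn (suc m C 2)
antidiagonalSign-C zero    = refl
antidiagonalSign-C (suc m) = begin
  sgn (suc m) * antidiagonalSign m     ≡⟨ cong (sgn (suc m) *_) (antidiagonalSign-C m) ⟩
  sgn (suc m) * sgn (suc m C 2)        ≡⟨ sym (sgn-+ (suc m) (suc m C 2)) ⟩
  sgn (suc m ℕ.+ suc m C 2)            ≡⟨ cong (λ x → sgn (x ℕ.+ suc m C 2)) (sym (nC1≡n (suc m))) ⟩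
  sgn (suc m C 1 ℕ.+ suc m C 2)        ≡⟨ cong sgn (nCk+nC[k+1]≡[n+1]C[k+1] (suc m) 1) ⟩
  sgn (suc (suc m) C 2)                ∎

-- Negative shifts

-- Z m k is C_{k-m}.
Z : ℕ → ℕ → ℚ
Z zero    k       = Cat k
Z (suc m) zero    = 0ℚ
Z (suc m) (suc k) = Z m k

catalan-Z : ∀ m k → catalan (k ℤ.⊖ m) ≡ Z m k
catalan-Z zero    k       = refl
catalan-Z (suc m) zero    = refl
catalan-Z (suc m) (suc k) = trans (cong catalan (ℤₚ.[1+m]⊖[1+n]≡m⊖n k m)) (catalan-Z m k)

Z-below : ∀ {m k} → k < m → Z m k ≡ 0ℚ
Z-below {suc m} {zero}  _         = refl
Z-below {suc m} {suc k} (s≤s k<m) = Z-below k<m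

Z-diagonal : ∀ m → Z m m ≡ 1ℚ
Z-diagonal zero    = refl
Z-diagonal (suc m) = Z-diagonal m

conv-δ : ∀ m i → conv (λ k → δ k m) i ≡ Z m i
conv-δ zero    zero    = refl
conv-δ zero    (suc i) = trans (cong₂ _+_ (*-identityˡ (Cat (suc i))) (conv-zero i)) (+-identityʳ (Cat (suc i)))
conv-δ (suc m) zero    = refl
conv-δ (suc m) (suc i) = trans (cong₂ _+_ (*-zeroˡ (Cat (suc i))) (conv-δ m i)) (+-identityˡ (Z m i))

sum-Z : ∀ n i (f : ℕ → ℚ) → i < n → sum {n} (λ k → Z (toℕ k) i * f (toℕ k)) ≡ conv f i
sum-Z (suc n) zero    f _ = trans
  (cong₂ _+_ (*-comm (Cat 0) (f 0)) (sum-zero {n} (λ k → 0ℚ * f (suc (toℕ k))) (λ k → *-zeroˡ (f (suc (toℕ k))))))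
  (+-identityʳ (f 0 * Cat 0))
sum-Z (suc n) (suc i) f (s≤s i<n) = cong₂ _+_ (*-comm (Cat (suc i)) (f 0)) (sum-Z n i (f ∘ suc) i<n)

-- M m = L⁻¹ A, where A i j = Z m (i + j) and L i k = Z k i is the Toeplitz matrix of c(x).
M : ℕ → ℕ → ℕ → ℚ
M m       k zero    = δ k m
M zero    k (suc j) = conv (λ c → Cat (k ℕ.+ c)) j
M (suc m) k (suc j) = M m k j

-- The equation is A = L M, so 1/c(x) is never constructed. C_{i+j-m} depends on the column through
-- j - m only; lowering j and m together ends in column 0, a shifted copy of c(x), or at m = 0 in a
-- later column, which is `conv-conv-Cat`.
conv-M : ∀ m j i → conv (λ k → M m k j) i ≡ Z m (i ℕ.+ j)
conv-M m       zero    i = trans (conv-δ m i) (cong (Z m) (sym (ℕₚ.+-identityʳ i)))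
conv-M zero    (suc j) i = trans (conv-conv-Cat j i) (cong Cat (sym (ℕₚ.+-suc i j)))
conv-M (suc m) (suc j) i = trans (conv-M m j i) (cong (Z (suc m)) (sym (ℕₚ.+-suc i j)))

M-left : ∀ m k j → j ≤ m → M m k j ≡ δ (k ℕ.+ j) m
M-left m       k zero    _         = cong (λ x → δ x m) (sym (ℕₚ.+-identityʳ k))
M-left (suc m) k (suc j) (s≤s j≤m) = trans (M-left m k j j≤m) (cong (λ x → δ x (suc m)) (sym (ℕₚ.+-suc k j)))

M-right : ∀ m k j → M m k (suc m ℕ.+ j) ≡ conv (λ c → Cat (k ℕ.+ c)) j
M-right zero    k j = refl
M-right (suc m) k j = M-right m k j

conv-sum : ∀ n b (l : Fin n → ℚ) (t : Fin n → ℕ → ℚ) →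
  conv (λ c → sum (λ k → l k * t k c)) b ≡ sum (λ k → l k * conv (t k) b)
conv-sum zero    b l t = conv-zero b
conv-sum (suc n) b l t = trans
  (conv-+ b (λ c → l zero * t zero c) (λ c → sum (λ k → l (suc k) * t (suc k) c)))
  (cong₂ _+_ (conv-* b (l zero) (t zero)) (conv-sum n b (l ∘ suc) (t ∘ suc)))

conv-last : ∀ n (f : ℕ → ℚ) → (∀ k → k < n → f k ≡ 0ℚ) → conv f n ≡ f n
conv-last zero    f eq = *-identityʳ (f 0)
conv-last (suc n) f eq = trans
  (cong₂ _+_ (trans (cong (_* Cat (suc n)) (eq 0 (s≤s z≤n))) (*-zeroˡ (Cat (suc n))))
    (conv-last n (f ∘ suc) (λ k k<n → eq (suc k) (s≤s k<n))))
  (+-identityˡ (f (suc n)))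

-- The convolution acts on columns. It is passed through the factor `L m` onto `T m`, which stays
-- upper triangular and keeps its diagonal because C_0 = 1.
det-conv-Cat : ∀ m n → det n (λ a b → conv (λ c → Cat (m ℕ.+ toℕ a ℕ.+ c)) (toℕ b)) ≡ product {n} (λ k → h m (toℕ k))
det-conv-Cat m n = begin
  det n (λ a b → conv (λ c → Cat (m ℕ.+ toℕ a ℕ.+ c)) (toℕ b))
    ≡⟨ det-cong n (λ a b → trans
         (conv-cong (toℕ b) (λ c c≤b → trans (cong Cat (ℕₚ.+-assoc m (toℕ a) c))
           (sym (L*T-Cat n m (toℕ a) c (ℕₚ.≤-<-trans c≤b (Finₚ.toℕ<n b))))))
         (conv-sum n (toℕ b) (λ k → L m (toℕ a) (toℕ k)) (λ k → T m (toℕ k)))) ⟩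
  det n (λ a b → sum {n} (λ k → L m (toℕ a) (toℕ k) * V (toℕ k) (toℕ b)))
    ≡⟨ det-L-* n m V V-below ⟩
  product {n} (λ k → V (toℕ k) (toℕ k))
    ≡⟨ product-cong n (λ k → V-diagonal (toℕ k)) ⟩
  product {n} (λ k → h m (toℕ k)) ∎
  where
  V : ℕ → ℕ → ℚ
  V k b = conv (T m k) b
  V-below : ∀ k b → b < k → V k b ≡ 0ℚ
  V-below k b b<k = trans (conv-cong b (λ c c≤b → T-below m k c (ℕₚ.≤-<-trans c≤b b<k))) (conv-zero b)
  V-diagonal : ∀ k → V k k ≡ h m k
  V-diagonal k = trans (conv-last k (T m k) (λ c c<k → T-below m k c c<k))
    (trans (cong (h m k *_) (L-diagonal m k)) (*-identityʳ (h m k)))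

det-Z : ∀ m n → det (suc m ℕ.+ n) (λ i j → Z m (toℕ i ℕ.+ toℕ j))
  ≡ antidiagonalSign m * product {n} (λ k → h (suc m) (toℕ k))
det-Z m n = begin
  det N (λ i j → Z m (toℕ i ℕ.+ toℕ j))
    ≡⟨ det-cong N (λ i j → trans (sym (conv-M m (toℕ j) (toℕ i)))
         (sym (sum-Z N (toℕ i) (λ k → M m k (toℕ j)) (Finₚ.toℕ<n i)))) ⟩
  det N (λ i j → sum {N} (λ k → Z (toℕ k) (toℕ i) * M m (toℕ k) (toℕ j)))
    ≡⟨ det-lowerUnitriangular-* N (λ i k → Z k i) (lowerUnitriangular Z-diagonal (λ i k i<k → Z-below i<k)) (λ k j → M m (toℕ k) (toℕ j)) ⟩
  det N (λ i j → M m (toℕ i) (toℕ j))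
    ≡⟨ det-antidiagonalBlock m n (M m) (M-left m) ⟩
  antidiagonalSign m * det n (λ a b → M m (suc m ℕ.+ toℕ a) (suc m ℕ.+ toℕ b))
    ≡⟨ cong (antidiagonalSign m *_) (trans
         -- The rows of the lower block start at m + 1; this offset is what becomes the Hankel shift
         -- m + 1.
         (det-cong n (λ a b → M-right m (suc m ℕ.+ toℕ a) (toℕ b)))
         (det-conv-Cat (suc m) n)) ⟩
  antidiagonalSign m * product {n} (λ k → h (suc m) (toℕ k)) ∎
  where
  N : ℕ
  N = suc m ℕ.+ n

det-Z-zero : ∀ m n → 1 ≤ n → n ≤ m → det n (λ i j → Z m (toℕ i ℕ.+ toℕ j)) ≡ 0ℚ
det-Z-zero m (suc n) _ n<m = sum-zero (λ j → sgn (toℕ j) * Z m (toℕ j) * minor j) λ j → begin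
  sgn (toℕ j) * Z m (toℕ j) * minor j    ≡⟨ cong (λ x → sgn (toℕ j) * x * minor j) (Z-below (ℕₚ.<-≤-trans (Finₚ.toℕ<n j) n<m)) ⟩
  sgn (toℕ j) * 0ℚ * minor j             ≡⟨ vanish (sgn (toℕ j)) (minor j) ⟩
  0ℚ                                     ∎
  where
  minor : Fin (suc n) → ℚ
  minor j = det n (λ r c → Z m (suc (toℕ r) ℕ.+ toℕ (punchIn j c)))
  vanish : ∀ x y → x * 0ℚ * y ≡ 0ℚ
  vanish = Solver.solve-∀ ℚ-ring

det-Z-p : ∀ m n → det n (λ i j → Z m (toℕ i ℕ.+ toℕ j)) ≡ p (suc m) (- fromℕ n)
-- `- fromℕ 0` computes to `fromℕ 0`, and the empty determinant and the empty product are both 1.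
det-Z-p m zero    = prod-h m 0
det-Z-p m (suc n) with suc n ℕₚ.≤? m
... | yes n<m = trans (det-Z-zero m (suc n) (s≤s z≤n) n<m) (sym (p-neg-zero m n n<m))
... | no  n≮m = subst (λ x → det x (λ i j → Z m (toℕ i ℕ.+ toℕ j)) ≡ p (suc m) (- fromℕ x))
  (ℕₚ.m+[n∸m]≡n {suc m} {suc n} (ℕₚ.≰⇒> n≮m)) (begin
    det (suc m ℕ.+ s) (λ i j → Z m (toℕ i ℕ.+ toℕ j))      ≡⟨ det-Z m s ⟩
    antidiagonalSign m * prod s (h (suc m))                 ≡⟨ cong (antidiagonalSign m *_) (prod-h m s) ⟩
    antidiagonalSign m * p (suc m) (fromℕ s)                ≡⟨ sym (p-reflect m s) ⟩
    p (suc m) (- fromℕ (suc m ℕ.+ s))                       ∎)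
  where
  s : ℕ
  s = suc n ∸ suc m

D-neg : ∀ m n → D (ℤ.- ℤ.+ m) n ≡ det n (λ i j → Z m (toℕ i ℕ.+ toℕ j))
D-neg m n = det-cong n λ i j → trans (cong catalan (index (toℕ i) (toℕ j))) (catalan-Z m (toℕ i ℕ.+ toℕ j))
  where
  index : ∀ i j → ℤ.- ℤ.+ m ℤ.+ ℤ.+ i ℤ.+ ℤ.+ j ≡ (i ℕ.+ j) ℤ.⊖ m
  index i j = begin
    ℤ.- ℤ.+ m ℤ.+ ℤ.+ i ℤ.+ ℤ.+ j      ≡⟨ ℤₚ.+-assoc (ℤ.- ℤ.+ m) (ℤ.+ i) (ℤ.+ j) ⟩
    ℤ.- ℤ.+ m ℤ.+ ℤ.+ (i ℕ.+ j)        ≡⟨ ℤₚ.+-comm (ℤ.- ℤ.+ m) (ℤ.+ (i ℕ.+ j)) ⟩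
    ℤ.+ (i ℕ.+ j) ℤ.- ℤ.+ m            ≡⟨ ℤₚ.m-n≡m⊖n (i ℕ.+ j) m ⟩
    (i ℕ.+ j) ℤ.⊖ m                    ∎

det-catalan : ∀ m n → det n (λ i j → catalan (ℤ.+ toℕ i ℤ.+ ℤ.+ toℕ j ℤ.- ℤ.+ m)) ≡ det n (λ i j → Z m (toℕ i ℕ.+ toℕ j))
det-catalan m n = det-cong n λ i j →
  trans (cong catalan (ℤₚ.m-n≡m⊖n (toℕ i ℕ.+ toℕ j) m)) (catalan-Z m (toℕ i ℕ.+ toℕ j))

D-p : ∀ m n → D (ℤ.+ suc m) n ≡ p (suc m) (fromℕ n)
D-p m n = trans (D-product (suc m) n) (prod-h m n)

D-neg-p : ∀ m n → suc m ≤ n → D (ℤ.- ℤ.+ m) n ≡ sgn (suc m C 2) * p (suc m) (fromℕ (n ∸ suc m))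
D-neg-p m n m<n = begin
  D (ℤ.- ℤ.+ m) n                                               ≡⟨ trans (D-neg m n) (det-Z-p m n) ⟩
  p (suc m) (- fromℕ n)                                         ≡⟨ cong (λ x → p (suc m) (- fromℕ x)) (sym (ℕₚ.m+[n∸m]≡n m<n)) ⟩
  p (suc m) (- fromℕ (suc m ℕ.+ (n ∸ suc m)))                   ≡⟨ p-reflect m (n ∸ suc m) ⟩
  antidiagonalSign m * p (suc m) (fromℕ (n ∸ suc m))            ≡⟨ cong (_* p (suc m) (fromℕ (n ∸ suc m))) (antidiagonalSign-C m) ⟩
  sgn (suc m C 2) * p (suc m) (fromℕ (n ∸ suc m))               ∎

open ℤ using (+_)

theorem1 : (m : ℕ) → 1 ≤ m →
    ((n : ℕ) →
    D (ℤ.- + m) n ≡ det n (λ i j → catalan (+ toℕ i ℤ.+ + toℕ j ℤ.- + m))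
    × det n (λ i j → catalan (+ toℕ i ℤ.+ + toℕ j ℤ.- + m)) ≡ p (m ℕ.+ 1) (- fromℕ n))
    × ((n : ℕ) → 1 ≤ n → n ≤ m → D (ℤ.- + m) n ≡ 0ℚ)
    × ((n : ℕ) → m ℕ.+ 1 ≤ n →
    D (ℤ.- + m) n ≡ (- 1ℚ) ^ ((m ℕ.+ 1) C 2) * p (m ℕ.+ 1) (fromℕ (n ∸ (m ℕ.+ 1)))
    × (- 1ℚ) ^ ((m ℕ.+ 1) C 2) * p (m ℕ.+ 1) (fromℕ (n ∸ (m ℕ.+ 1)))
    ≡ (- 1ℚ) ^ ((m ℕ.+ 1) C 2) * D (+ (m ℕ.+ 1)) (n ∸ (m ℕ.+ 1)))
-- The lemmas speak of `suc m`, to which `m ℕ.+ 1` does not reduce.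
theorem1 m _ rewrite ℕₚ.+-comm m 1 =
    (λ n → trans (D-neg m n) (sym (det-catalan m n)) , trans (det-catalan m n) (det-Z-p m n))
  , (λ n 1≤n n≤m → trans (D-neg m n) (det-Z-zero m n 1≤n n≤m))
  , (λ n m<n → D-neg-p m n m<n , cong (sgn (suc m C 2) *_) (sym (D-p m (n ∸ suc m))))
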